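{- Let $q$ be a prime power, $n \geq 1$, $\lambda > 0$, $\eta > 0$, and let $\Lambda > 0$ be an integer with $\eta q > \Lambda$. Let $S \subseteq \mathbb{F}_q^n$ with $|S| = \lambda q^n$. Let $K \subseteq \mathbb{F}_q^n$ be such that for each $\mathbf{x} \in S$ there exists a curve $C_{\mathbf{x}}$ of degree at most $\Lambda$ that passes through $\mathbf{x}$ and intersects $K$ in at least $\eta q$ points, i.e. $|\{t \in \mathbb{F}_q : C_{\mathbf{x}}(t) \in K\}| \geq \eta q$. Then $$|K| \geq \left(\frac{\lambda q}{\Lambda\left(\frac{\lambda q - 1}{\eta q}\right) + 1}\right)^n.$$ In particular, if $\lambda \geq \eta$, then $|K| \geq \left(\frac{\eta q}{\Lambda + 1}\right)^n$.
   Context: A curve of degree $\Lambda$ in $\mathbb{F}_q^n$ is a tuple $C(X) = (C_1(X),\ldots,C_n(X)) \in \mathbb{F}_q[X]^n$ with $\max_i \deg C_i = \Lambda$; it defines a map $\mathbb{F}_q \to \mathbb{F}_q^n$, $t \mapsto C(t)$. A curve $C$ passes through $\mathbf{x}$ if $C(t) = \mathbf{x}$ for some $t \in \mathbb{F}_q$.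
   Formalization: The parameter η is taken to be a rational number instead of a real one (λ is automatically rational since |S| = λq^n); the real case follows by letting rational η′ increase to η. -}

module Defs where

open import Data.Nat using (ℕ; zero; suc)
open import Data.Fin using (Fin)
open import Data.Bool using (Bool; true; false; if_then_else_)
open import Data.List using (List; []; _∷_; concatMap)
open import Data.Nat.ListAction using (sum)
import Data.List as List
open import Data.Vec using (Vec; []; _∷_)
import Data.Vec as Vec
open import Data.Product using (∃; _×_)
open import Data.Integer using (+_)
open import Data.Rational using (ℚ; _/_; _*_; 0ℚ; 1ℚ; _≟_; _÷_; ≢-nonZero)
open import Relation.Nullary using (yes; no)
open import Relation.Binary.PropositionalEquality using (_≡_; _≢_)
open import Algebra.Structures using (IsCommutativeRing)

-- A finite field with exactly q elements, realised on the carrier Fin q.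
-- (Any finite field of order q forces q to be a prime power.)
record FiniteField (q : ℕ) : Set where
  field
    _+F_ _*F_ : Fin q → Fin q → Fin q
    -F_ : Fin q → Fin q
    0F 1F : Fin q
    isCommutativeRing : IsCommutativeRing _≡_ _+F_ _*F_ -F_ 0F 1F
    0≢1 : 0F ≢ 1F
    inverse : ∀ x → x ≢ 0F → ∃ λ y → x *F y ≡ 1F

Point : ℕ → ℕ → Set
Point q n = Vec (Fin q) n

-- A polynomial of degree at most Λ: coefficients c_0 , … , c_Λ.
Poly≤ : ℕ → ℕ → Set
Poly≤ q Λ = Vec (Fin q) (suc Λ)

Curve≤ : ℕ → ℕ → ℕ → Set
Curve≤ q n Λ = Vec (Poly≤ q Λ) n

evalPoly : ∀ {q k} → FiniteField q → Vec (Fin q) k → Fin q → Fin q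
evalPoly F [] t = FiniteField.0F F
evalPoly F (c ∷ cs) t = FiniteField._+F_ F c (FiniteField._*F_ F t (evalPoly F cs t))

curveAt : ∀ {q n Λ} → FiniteField q → Curve≤ q n Λ → Fin q → Point q n
curveAt F C t = Vec.map (λ cs → evalPoly F cs t) C

PassesThrough : ∀ {q n Λ} → FiniteField q → Curve≤ q n Λ → Point q n → Set
PassesThrough F C x = ∃ λ t → curveAt F C t ≡ x

countTrue : ∀ {A : Set} → (A → Bool) → List A → ℕ
countTrue P xs = sum (List.map (λ x → if P x then 1 else 0) xs)

allPoints : (q n : ℕ) → List (Point q n)
allPoints q zero = [] ∷ []
allPoints q (suc n) = concatMap (λ a → List.map (a ∷_) (allPoints q n)) (List.allFin q)

card : ∀ {q n} → (Point q n → Bool) → ℕ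
card {q} {n} S = countTrue S (allPoints q n)

hits : ∀ {q n Λ} → FiniteField q → Curve≤ q n Λ → (Point q n → Bool) → ℕ
hits {q} F C K = countTrue (λ t → K (curveAt F C t)) (List.allFin q)

ℕtoℚ : ℕ → ℚ
ℕtoℚ n = (+ n) / 1

_^ℚ_ : ℚ → ℕ → ℚ
p ^ℚ zero = 1ℚ
p ^ℚ suc n = p * (p ^ℚ n)

-- Total division (x / 0 := 0); only ever applied to provably nonzero divisors.
_÷'_ : ℚ → ℚ → ℚ
p ÷' d with d ≟ 0ℚ
... | yes _ = 0ℚ
... | no d≢0 = _÷_ p d {{≢-nonZero d≢0}}

{-# OPTIONS --safe #-}
-- The method of multiplicities.  If K is small, counting coefficients gives a nonzero polynomial P of degree < D
-- vanishing to order m on K.  Along a curve C of degree ≤ Λ, a Hasse derivative of P of weight w < ℓ is a univariate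
-- polynomial of degree ≤ Λ(D − 1 − w) with a zero of order m − w at each t with C(t) ∈ K.  As soon as
-- m ≥ Λ(D − ℓ)/(ηq) + ℓ these are too many zeros, so P vanishes to order ℓ on S, which contradicts the Schwartz–Zippel
-- lemma with multiplicities when D ≤ λℓq.  Letting ℓ → ∞ with m/ℓ and D/ℓ fixed gives the bound when λq ≥ 1;
-- when λq ≤ 1 the bound is at most 1.
module Submission where

open import Defs
open import Algebra.Bundles using (CommutativeRing)
import Algebra.Properties.Ring as RingProperties
import Algebra.Solver.Ring.NaturalCoefficients.Default as SemiringSolver
open import Data.Bool using (Bool; true; false; if_then_else_)
open import Data.Empty using (⊥-elim)
open import Data.Fin using (Fin; zero; suc; _↑ˡ_; _↑ʳ_; splitAt; combine; finToFun; funToFin)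
open import Data.Fin.Properties using (splitAt⁻¹-↑ˡ; splitAt⁻¹-↑ʳ; pigeonhole; finToFun-funToFin; funToFin-finToFin) renaming (_≟_ to _≟F_; <⇒≢ to <⇒≢F)
open import Data.List using (List; []; _∷_; _++_; length; concatMap; allFin; map)
import Data.List as List
open import Data.List.Properties using (map-tabulate; map-++; map-∘; length-++; length-map; length-tabulate)
open import Data.List.Membership.Propositional using (_∈_; find; lose)
open import Data.List.Membership.Propositional.Properties using (∈-map⁺; ∈-++⁺ˡ; ∈-++⁺ʳ; ∈-allFin; ∈-concatMap⁺)
open import Data.List.Relation.Unary.All using (All; []; _∷_)
open import Data.List.Relation.Unary.Any using (any?; here; there; index)
open import Data.List.Relation.Unary.Any.Properties using (lookup-index)
open import Data.Nat using (ℕ; zero; suc; pred; z≤n; s≤s)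
import Data.Nat as ℕ
open import Data.Nat.ListAction using (sum)
open import Data.Nat.ListAction.Properties using (sum-++)
import Data.Nat.Properties as ℕₚ
import Data.Nat.Solver as ℕ-Solver
open import Data.Product using (∃; ∃₂; _×_; _,_; proj₁; proj₂)
open import Data.Sum using (inj₁; inj₂; [_,_]′)
open import Data.Unit using (⊤; tt)
open import Data.Vec using (Vec; []; _∷_)
import Data.Vec as Vec
open import Function using (_∘_)
open import Level using (0ℓ)
open import Relation.Nullary using (yes; no; Dec; ¬_)
open import Relation.Nullary.Decidable using (¬?; _×-dec_; decidable-stable)
open import Relation.Binary.PropositionalEquality using (_≡_; _≢_; refl; sym; trans; cong; cong₂; subst; subst₂; module ≡-Reasoning)

-- Univariate polynomials over a finite field

-- Ordinary derivatives lose information in characteristic p, so multiplicities are read off Taylor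
-- coefficients, computed by Horner recursion. The delicate step is that a Hasse derivative of
-- weight w, restricted to C, keeps order m - w where C(t) lies in K. Instead of composing Hasse
-- derivatives, P(C(t + τ) + Y) is expanded in τ and Y at once. With C(t + τ) = C(t) + Δ it is
-- P(C(t) + X) at X = Δ + Y; as τ divides Δ, every factor Δ + Y has order at least one in (τ, Y)
-- jointly, so the coefficient of Y^i τ^k vanishes whenever |i| + k < m. The value of m comes from
-- requiring Λ(D - w) ≤ ηq(m - w) for all w < ℓ. Both sides are linear in w, and ηq > Λ makes w = ℓ
-- the extreme case. Taking D = λℓq gives D - ℓ = (λq - 1)ℓ, hence m/ℓ = Λ(λq - 1)/(ηq) + 1: the
-- bound is (D/m)^n, and λq ≥ 1 is what keeps D - ℓ nonnegative.

sumFin : ∀ {n} → (Fin n → ℕ) → ℕ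
sumFin {zero}  ν = 0
sumFin {suc n} ν = ν zero ℕ.+ sumFin (ν ∘ suc)

decrementAt : ∀ {n} → (Fin n → ℕ) → Fin n → Fin n → ℕ
decrementAt ν zero    zero    = pred (ν zero)
decrementAt ν zero    (suc y) = ν (suc y)
decrementAt ν (suc z) zero    = ν zero
decrementAt ν (suc z) (suc y) = decrementAt (ν ∘ suc) z y

decrementAt-same : ∀ {n} (ν : Fin n → ℕ) z → decrementAt ν z z ≡ pred (ν z)
decrementAt-same ν zero    = refl
decrementAt-same ν (suc z) = decrementAt-same (ν ∘ suc) z

decrementAt-other : ∀ {n} (ν : Fin n → ℕ) z y → y ≢ z → decrementAt ν z y ≡ ν y
decrementAt-other ν zero    zero    y≢z with () ← y≢z refl
decrementAt-other ν zero    (suc y) y≢z = refl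
decrementAt-other ν (suc z) zero    y≢z = refl
decrementAt-other ν (suc z) (suc y) y≢z = decrementAt-other (ν ∘ suc) z y (y≢z ∘ cong suc)

sumFin-decrementAt : ∀ {n} (ν : Fin n → ℕ) z → sumFin ν ℕ.≤ suc (sumFin (decrementAt ν z))
sumFin-decrementAt ν zero with ν zero
... | zero  = ℕₚ.n≤1+n _
... | suc _ = ℕₚ.≤-refl
sumFin-decrementAt ν (suc z) = ℕₚ.≤-trans (ℕₚ.+-monoʳ-≤ (ν zero) (sumFin-decrementAt (ν ∘ suc) z))
  (ℕₚ.≤-reflexive (ℕₚ.+-suc (ν zero) _))

positive-summand : ∀ {n} (ν : Fin n → ℕ) → 1 ℕ.≤ sumFin ν → ∃ λ z → 1 ℕ.≤ ν z
positive-summand {suc n} ν 1≤ with ν zero in eq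
... | suc k = zero , subst (1 ℕ.≤_) (sym eq) (s≤s z≤n)
... | zero with positive-summand (ν ∘ suc) 1≤
... | z , 1≤νz = suc z , 1≤νz

module Field {q : ℕ} (F : FiniteField q) where
  open ≡-Reasoning
  open FiniteField F public
    renaming (_+F_ to infixl 6 _+F_; _*F_ to infixl 7 _*F_; -F_ to infix 8 -F_)

  commutativeRing : CommutativeRing 0ℓ 0ℓ
  commutativeRing = record { isCommutativeRing = isCommutativeRing }

  open CommutativeRing commutativeRing public
    using (ring; commutativeSemiring; +-assoc; +-comm; +-identityˡ; +-identityʳ; -‿inverseˡ; -‿inverseʳ
          ; *-identityˡ; distribʳ; zeroˡ; zeroʳ)
  open RingProperties ring public
    using (x∙y⁻¹≈ε⇒x≈y; +-identityˡ-unique)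
  open SemiringSolver commutativeSemiring public
    using (solve; _:=_; _:+_; _:*_; con)

  0+0 : ∀ {x y} → x ≡ 0F → y ≡ 0F → x +F y ≡ 0F
  0+0 refl refl = +-identityˡ 0F

  *-zero : ∀ {x} c → x ≡ 0F → c *F x ≡ 0F
  *-zero c refl = zeroʳ c

  *-cancel-nonZero : ∀ {x} c → c ≢ 0F → c *F x ≡ 0F → x ≡ 0F
  *-cancel-nonZero {x} c c≢0 cx≡0 with inverse c c≢0
  ... | d , cd≡1 = begin
    x               ≡⟨ *-identityˡ x ⟨
    1F *F x         ≡⟨ cong (_*F x) cd≡1 ⟨
    (c *F d) *F x   ≡⟨ solve 3 (λ c d x → (c :* d) :* x := d :* (c :* x)) refl c d x ⟩
    d *F (c *F x)   ≡⟨ *-zero d cx≡0 ⟩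
    0F              ∎

  *-diff-zero : ∀ {y z x} → y ≢ z → z *F x ≡ y *F x → x ≡ 0F
  *-diff-zero {y} {z} {x} y≢z zx≡yx = *-cancel-nonZero (y +F (-F z)) (y≢z ∘ x∙y⁻¹≈ε⇒x≈y y z) (begin
    (y +F (-F z)) *F x          ≡⟨ distribʳ x y (-F z) ⟩
    y *F x +F (-F z) *F x       ≡⟨ cong (_+F (-F z) *F x) zx≡yx ⟨
    z *F x +F (-F z) *F x       ≡⟨ distribʳ x z (-F z) ⟨
    (z +F (-F z)) *F x          ≡⟨ cong (_*F x) (-‿inverseʳ z) ⟩
    0F *F x                     ≡⟨ zeroˡ x ⟩
    0F                          ∎)

  -- taylor z j g is the coefficient of τ^j in g(z + τ).
  taylor : Fin q → ℕ → List (Fin q) → Fin q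
  taylor z j       []      = 0F
  taylor z zero    (c ∷ g) = c +F z *F taylor z zero g
  taylor z (suc j) (c ∷ g) = z *F taylor z (suc j) g +F taylor z j g

  -- Synthetic division: c ∷ g = (c ∷ g)(z) + (X − z) · quotient z g.
  quotient : Fin q → List (Fin q) → List (Fin q)
  quotient z []      = []
  quotient z (c ∷ g) = taylor z 0 (c ∷ g) ∷ quotient z g

  length-quotient : ∀ z g → length (quotient z g) ≡ length g
  length-quotient z []      = refl
  length-quotient z (c ∷ g) = cong suc (length-quotient z g)

  -- At X = z + τ the divisor X - z is τ itself, so dividing by it shifts the Taylor coefficients at
  -- z by one place.
  taylor-quotient : ∀ z c g j → taylor z j (quotient z g) ≡ taylor z (suc j) (c ∷ g)
  taylor-quotient z c [] j = sym (0+0 (zeroʳ z) refl)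
  taylor-quotient z c (d ∷ g) zero = begin
    taylor z 0 (d ∷ g) +F z *F taylor z 0 (quotient z g)
      ≡⟨ +-comm _ _ ⟩
    z *F taylor z 0 (quotient z g) +F taylor z 0 (d ∷ g)
      ≡⟨ cong (λ u → z *F u +F taylor z 0 (d ∷ g)) (taylor-quotient z d g 0) ⟩
    z *F taylor z 1 (d ∷ g) +F taylor z 0 (d ∷ g) ∎
  taylor-quotient z c (d ∷ g) (suc j) =
    cong₂ (λ u v → z *F u +F v) (taylor-quotient z d g (suc j)) (taylor-quotient z d g j)

  -- Taylor expansion at y of  g + z · quotient z g' = g(z) + X · quotient z g',  g = c ∷ g'.
  division-at₀ : ∀ y z c g → taylor y 0 (c ∷ g) +F z *F taylor y 0 (quotient z g)
                           ≡ taylor z 0 (c ∷ g) +F y *F taylor y 0 (quotient z g)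
  division-at₀ y z c [] = solve 3 (λ y z c → (c :+ y :* con 0) :+ z :* con 0 := (c :+ z :* con 0) :+ y :* con 0) refl y z c
  division-at₀ y z c (d ∷ g) = begin
    (c +F y *F A) +F z *F (B +F y *F Q)   ≡⟨ solve 6 (λ y z c A B Q → (c :+ y :* A) :+ z :* (B :+ y :* Q) := (c :+ z :* B) :+ y :* (A :+ z :* Q)) refl y z c A B Q ⟩
    (c +F z *F B) +F y *F (A +F z *F Q)   ≡⟨ cong (λ u → (c +F z *F B) +F y *F u) (division-at₀ y z d g) ⟩
    (c +F z *F B) +F y *F (B +F y *F Q)   ∎
    where
    A = taylor y 0 (d ∷ g)
    B = taylor z 0 (d ∷ g)
    Q = taylor y 0 (quotient z g)

  division-at : ∀ y z c g j → taylor y (suc j) (c ∷ g) +F z *F taylor y (suc j) (quotient z g)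
                            ≡ y *F taylor y (suc j) (quotient z g) +F taylor y j (quotient z g)
  division-at y z c [] j = solve 2 (λ y z → (y :* con 0 :+ con 0) :+ z :* con 0 := y :* con 0 :+ con 0) refl y z
  division-at y z c (d ∷ g) zero = begin
    (y *F A₁ +F A) +F z *F (y *F Q₁ +F Q)   ≡⟨ solve 6 (λ y z A₁ A Q₁ Q → (y :* A₁ :+ A) :+ z :* (y :* Q₁ :+ Q) := y :* (A₁ :+ z :* Q₁) :+ (A :+ z :* Q)) refl y z A₁ A Q₁ Q ⟩
    y *F (A₁ +F z *F Q₁) +F (A +F z *F Q)   ≡⟨ cong₂ (λ u v → y *F u +F v) (division-at y z d g 0) (division-at₀ y z d g) ⟩
    y *F (y *F Q₁ +F Q) +F (taylor z 0 (d ∷ g) +F y *F Q) ∎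
    where
    A  = taylor y 0 (d ∷ g)
    A₁ = taylor y 1 (d ∷ g)
    Q  = taylor y 0 (quotient z g)
    Q₁ = taylor y 1 (quotient z g)
  division-at y z c (d ∷ g) (suc j) = begin
    (y *F A₁ +F A) +F z *F (y *F Q₁ +F Q)   ≡⟨ solve 6 (λ y z A₁ A Q₁ Q → (y :* A₁ :+ A) :+ z :* (y :* Q₁ :+ Q) := y :* (A₁ :+ z :* Q₁) :+ (A :+ z :* Q)) refl y z A₁ A Q₁ Q ⟩
    y *F (A₁ +F z *F Q₁) +F (A +F z *F Q)   ≡⟨ cong₂ (λ u v → y *F u +F v) (division-at y z d g (suc j)) (division-at y z d g j) ⟩
    y *F (y *F Q₁ +F Q) +F (y *F Q +F taylor y j (quotient z g)) ∎
    where
    A  = taylor y (suc j) (d ∷ g)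
    A₁ = taylor y (suc (suc j)) (d ∷ g)
    Q  = taylor y (suc j) (quotient z g)
    Q₁ = taylor y (suc (suc j)) (quotient z g)

  -- Here the dividend is (X - z) times the quotient. Comparing coefficients at y expresses (y - z)
  -- times the j-th coefficient of the quotient through its predecessor; since y - z is invertible,
  -- induction on j applies.
  quotient-order-other : ∀ {y z} c g r → y ≢ z → taylor z 0 (c ∷ g) ≡ 0F →
    (∀ j → j ℕ.< r → taylor y j (c ∷ g) ≡ 0F) → ∀ j → j ℕ.< r → taylor y j (quotient z g) ≡ 0F
  quotient-order-other {y} {z} c g r y≢z gz≡0 gy≡0 zero 0<r = *-diff-zero y≢z (begin
    z *F taylor y 0 (quotient z g)                         ≡⟨ +-identityˡ _ ⟨
    0F +F z *F taylor y 0 (quotient z g)                   ≡⟨ cong (_+F z *F taylor y 0 (quotient z g)) (gy≡0 0 0<r) ⟨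
    taylor y 0 (c ∷ g) +F z *F taylor y 0 (quotient z g)   ≡⟨ division-at₀ y z c g ⟩
    taylor z 0 (c ∷ g) +F y *F taylor y 0 (quotient z g)   ≡⟨ cong (_+F y *F taylor y 0 (quotient z g)) gz≡0 ⟩
    0F +F y *F taylor y 0 (quotient z g)                   ≡⟨ +-identityˡ _ ⟩
    y *F taylor y 0 (quotient z g)                         ∎)
  quotient-order-other {y} {z} c g r y≢z gz≡0 gy≡0 (suc j) j<r = *-diff-zero y≢z (begin
    z *F Q                              ≡⟨ +-identityˡ _ ⟨
    0F +F z *F Q                        ≡⟨ cong (_+F z *F Q) (gy≡0 (suc j) j<r) ⟨
    taylor y (suc j) (c ∷ g) +F z *F Q  ≡⟨ division-at y z c g j ⟩
    y *F Q +F taylor y j (quotient z g) ≡⟨ cong (y *F Q +F_) (quotient-order-other c g r y≢z gz≡0 gy≡0 j (ℕₚ.<-trans (ℕₚ.n<1+n j) j<r)) ⟩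
    y *F Q +F 0F                        ≡⟨ +-identityʳ _ ⟩
    y *F Q                              ∎)
    where Q = taylor y (suc j) (quotient z g)

  quotient-zero : ∀ z c g → taylor z 0 (c ∷ g) ≡ 0F → All (_≡ 0F) (quotient z g) → All (_≡ 0F) (c ∷ g)
  quotient-zero z c [] gz≡0 [] = trans (sym (trans (cong (c +F_) (zeroʳ z)) (+-identityʳ c))) gz≡0 ∷ []
  quotient-zero z c (d ∷ g) gz≡0 (r≡0 ∷ q≡0) =
    trans (sym (trans (cong (c +F_) (*-zero z r≡0)) (+-identityʳ c))) gz≡0 ∷ quotient-zero z d g r≡0 q≡0

  -- Divide by X - z at some z with ν z ≥ 1: the length drops by one, ν drops by one at z only, and
  -- all remaining orders survive. The length serves as recursion measure because the quotient is
  -- not a subterm.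
  roots-bound : ∀ g (ν : Fin q → ℕ) → (∀ z j → j ℕ.< ν z → taylor z j g ≡ 0F) →
    length g ℕ.≤ sumFin ν → All (_≡ 0F) g
  roots-bound g ν = go (length g) g ν refl
    where
    go : ∀ k g (ν : Fin q → ℕ) → length g ≡ k → (∀ z j → j ℕ.< ν z → taylor z j g ≡ 0F) →
      length g ℕ.≤ sumFin ν → All (_≡ 0F) g
    go k [] ν _ _ _ = []
    go (suc k) (c ∷ g) ν len≡ van len≤ with positive-summand ν (ℕₚ.≤-trans (s≤s z≤n) len≤)
    ... | z , 1≤νz = quotient-zero z c g gz≡0 (go k (quotient z g) (decrementAt ν z)
        (trans (length-quotient z g) (ℕₚ.suc-injective len≡)) van'
        (subst (ℕ._≤ sumFin (decrementAt ν z)) (sym (length-quotient z g))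
          (ℕ.s≤s⁻¹ (ℕₚ.≤-trans len≤ (sumFin-decrementAt ν z)))))
      where
      gz≡0 = van z 0 1≤νz
      van' : ∀ y j → j ℕ.< decrementAt ν z y → taylor y j (quotient z g) ≡ 0F
      van' y j j< with y ≟F z
      ... | yes refl = trans (taylor-quotient z c g j) (van z (suc j) (pred-< (subst (j ℕ.<_) (decrementAt-same ν z) j<)))
        where
        pred-< : ∀ {j m} → j ℕ.< pred m → suc j ℕ.< m
        pred-< {m = suc m} p = s≤s p
      ... | no y≢z = quotient-order-other c g (ν y) y≢z gz≡0 (van y) j (subst (j ℕ.<_) (decrementAt-other ν z y y≢z) j<)

-- Multivariate polynomials and their Taylor expansions along curves

-- Polynomials in n variables of total degree < D; in P +X· Q the variable X is the first one.
data Polynomial (A : Set) : ℕ → ℕ → Set where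
  none  : ∀ {n} → Polynomial A n 0
  const : ∀ {D} → A → Polynomial A 0 (suc D)
  _+X·_ : ∀ {n D} → Polynomial A n (suc D) → Polynomial A (suc n) D → Polynomial A (suc n) (suc D)

-- The same Horner recursion is run on scalars (Hasse derivatives at a point, and plain
-- coefficients), on power series in τ and on coefficient lists. No laws are demanded, since the
-- runs are only compared with each other through `expand-rel`.
record RawValues (A : Set) : Set₁ where
  field
    Carrier : Set
    _⊕_     : Carrier → Carrier → Carrier
    0#      : Carrier
    ι       : A → Carrier

module _ {A : Set} (V : RawValues A) {E : Set} (op : E → RawValues.Carrier V → RawValues.Carrier V) where
  open RawValues V

  -- The coefficient of Y^i in P(e + Y), where op e is multiplication by e.
  expand : ∀ {n D} → Vec E n → Vec ℕ n → Polynomial A n D → Carrier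
  expand es       is           none      = 0#
  expand []       []           (const c) = ι c
  expand (e ∷ es) (zero  ∷ is) (P +X· Q) = expand es is P ⊕ op e (expand (e ∷ es) (zero ∷ is) Q)
  expand (e ∷ es) (suc j ∷ is) (P +X· Q) = op e (expand (e ∷ es) (suc j ∷ is) Q) ⊕ expand (e ∷ es) (j ∷ is) Q

-- Parametricity of `expand`: a relation respected by the operations is respected by the results. It
-- serves for passing to constant terms and for matching lists with their Taylor series.
expand-rel : ∀ {A E : Set} (V W : RawValues A) → let module V = RawValues V; module W = RawValues W in
  (opV : E → V.Carrier → V.Carrier) (opW : E → W.Carrier → W.Carrier)
  (R : V.Carrier → W.Carrier → Set) →
  R V.0# W.0# → (∀ c → R (V.ι c) (W.ι c)) →
  (∀ {u u' v v'} → R u v → R u' v' → R (u V.⊕ u') (v W.⊕ v')) →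
  (∀ e {u v} → R u v → R (opV e u) (opW e v)) →
  ∀ {n D} (es : Vec E n) (is : Vec ℕ n) (P : Polynomial A n D) → R (expand V opV es is P) (expand W opW es is P)
expand-rel {A} {E} V W opV opW R R0 Rι R⊕ Rop = go
  where
  go : ∀ {n D} (es : Vec E n) (is : Vec ℕ n) (P : Polynomial A n D) → R (expand V opV es is P) (expand W opW es is P)
  go es       is           none      = R0
  go []       []           (const c) = Rι c
  go (e ∷ es) (zero  ∷ is) (P +X· Q) = R⊕ (go es is P) (Rop e (go (e ∷ es) (zero ∷ is) Q))
  go (e ∷ es) (suc j ∷ is) (P +X· Q) = R⊕ (Rop e (go (e ∷ es) (suc j ∷ is) Q)) (go (e ∷ es) (j ∷ is) Q)

expand-map : ∀ {A E E' : Set} (V : RawValues A) (op : E' → RawValues.Carrier V → RawValues.Carrier V) (h : E → E')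
  {n D : ℕ} (es : Vec E n) (is : Vec ℕ n) (P : Polynomial A n D) →
  expand V (λ e → op (h e)) es is P ≡ expand V op (Vec.map h es) is P
expand-map V op h es       is           none      = refl
expand-map V op h []       []           (const c) = refl
expand-map V op h (e ∷ es) (zero  ∷ is) (P +X· Q) =
  cong₂ (λ u v → u ⊕ op (h e) v) (expand-map V op h es is P) (expand-map V op h (e ∷ es) (zero ∷ is) Q)
  where open RawValues V
expand-map V op h (e ∷ es) (suc j ∷ is) (P +X· Q) =
  cong₂ (λ u v → op (h e) u ⊕ v) (expand-map V op h (e ∷ es) (suc j ∷ is) Q) (expand-map V op h (e ∷ es) (j ∷ is) Q)
  where open RawValues V

module Multivariate {q : ℕ} (F : FiniteField q) where
  open ≡-Reasoning
  open Field F

  𝔽 : Set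
  𝔽 = Fin q

  Poly : ℕ → ℕ → Set
  Poly = Polynomial 𝔽

  scalars : RawValues 𝔽
  scalars = record { Carrier = 𝔽 ; _⊕_ = _+F_ ; 0# = 0F ; ι = λ c → c }

  hasse : ∀ {n D} → Point q n → Vec ℕ n → Poly n D → 𝔽
  hasse = expand scalars _*F_

  Series : Set
  Series = ℕ → 𝔽

  constSeries : 𝔽 → Series
  constSeries c zero    = c
  constSeries c (suc k) = 0F

  series : RawValues 𝔽
  series = record { Carrier = Series ; _⊕_ = λ u v k → u k +F v k ; 0# = λ _ → 0F ; ι = constSeries }

  _⊞_ : List 𝔽 → List 𝔽 → List 𝔽
  []       ⊞ v        = v
  (x ∷ u)  ⊞ []       = x ∷ u
  (x ∷ u)  ⊞ (y ∷ v)  = (x +F y) ∷ (u ⊞ v)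

  univariate : RawValues 𝔽
  univariate = record { Carrier = List 𝔽 ; _⊕_ = _⊞_ ; 0# = [] ; ι = λ c → c ∷ [] }

  -- The empty list is not padded: a zero polynomial must keep length 0, or the degree count would
  -- fail once the weight exhausts the degree.
  timesX : List 𝔽 → List 𝔽
  timesX []      = []
  timesX (x ∷ u) = 0F ∷ x ∷ u

  mulUnivariate : ∀ {k} → Vec 𝔽 k → List 𝔽 → List 𝔽
  mulUnivariate []       u = []
  mulUnivariate (c ∷ cs) u = map (c *F_) u ⊞ timesX (mulUnivariate cs u)

  delay : Series → Series
  delay u zero    = 0F
  delay u (suc k) = u k

  -- Multiplication by cs(t + τ), and by cs(t + τ) − cs(t), on series in τ.
  mulSeries : ∀ {k} → 𝔽 → Vec 𝔽 k → Series → Series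
  mulSeries t []       u k = 0F
  mulSeries t (c ∷ cs) u k = c *F u k +F (t *F mulSeries t cs u k +F delay (mulSeries t cs u) k)

  incSeries : ∀ {k} → 𝔽 → Vec 𝔽 k → Series → Series
  incSeries t []       u k = 0F
  incSeries t (c ∷ cs) u k = t *F incSeries t cs u k +F delay (mulSeries t cs u) k

  mulSeries-inc : ∀ {l} t (cs : Vec 𝔽 l) u k → mulSeries t cs u k ≡ incSeries t cs u k +F evalPoly F cs t *F u k
  mulSeries-inc t [] u k = solve 1 (λ u → con 0 := con 0 :+ con 0 :* u) refl (u k)
  mulSeries-inc t (c ∷ cs) u k = begin
    c *F u k +F (t *F mulSeries t cs u k +F D)
      ≡⟨ cong (λ x → c *F u k +F (t *F x +F D)) (mulSeries-inc t cs u k) ⟩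
    c *F u k +F (t *F (G +F e *F u k) +F D)
      ≡⟨ solve 6 (λ c u t G e D → c :* u :+ (t :* (G :+ e :* u) :+ D) := (t :* G :+ D) :+ (c :+ t :* e) :* u) refl c (u k) t G e D ⟩
    (t *F G +F D) +F (c +F t *F e) *F u k ∎
    where
    D = delay (mulSeries t cs u) k
    G = incSeries t cs u k
    e = evalPoly F cs t

  delay-cong : ∀ {u v} → (∀ k → u k ≡ v k) → ∀ k → delay u k ≡ delay v k
  delay-cong u≡v zero    = refl
  delay-cong u≡v (suc k) = u≡v k

  mulSeries-cong : ∀ {l} t (cs : Vec 𝔽 l) {u v} → (∀ k → u k ≡ v k) → ∀ k → mulSeries t cs u k ≡ mulSeries t cs v k
  mulSeries-cong t []       u≡v k = refl
  mulSeries-cong t (c ∷ cs) u≡v k = cong₂ _+F_ (cong (c *F_) (u≡v k))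
    (cong₂ _+F_ (cong (t *F_) (mulSeries-cong t cs u≡v k)) (delay-cong (mulSeries-cong t cs u≡v) k))

  incSeries-cong : ∀ {l} t (cs : Vec 𝔽 l) {u v} → (∀ k → u k ≡ v k) → ∀ k → incSeries t cs u k ≡ incSeries t cs v k
  incSeries-cong t []       u≡v k = refl
  incSeries-cong t (c ∷ cs) u≡v k =
    cong₂ _+F_ (cong (t *F_) (incSeries-cong t cs u≡v k)) (delay-cong (mulSeries-cong t cs u≡v) k)

  delay-axpy : ∀ u z v k → delay (λ k → u k +F z *F v k) k ≡ delay u k +F z *F delay v k
  delay-axpy u z v zero    = sym (0+0 refl (zeroʳ z))
  delay-axpy u z v (suc k) = refl

  mulSeries-axpy : ∀ {l} t (cs : Vec 𝔽 l) u z v k →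
    mulSeries t cs (λ k → u k +F z *F v k) k ≡ mulSeries t cs u k +F z *F mulSeries t cs v k
  mulSeries-axpy t [] u z v k = sym (0+0 refl (zeroʳ z))
  mulSeries-axpy t (c ∷ cs) u z v k = begin
    c *F (u k +F z *F v k) +F (t *F mulSeries t cs (λ k → u k +F z *F v k) k +F delay (mulSeries t cs (λ k → u k +F z *F v k)) k)
      ≡⟨ cong₂ (λ x y → c *F (u k +F z *F v k) +F (t *F x +F y)) (mulSeries-axpy t cs u z v k)
           (trans (delay-cong (mulSeries-axpy t cs u z v) k) (delay-axpy (mulSeries t cs u) z (mulSeries t cs v) k)) ⟩
    c *F (u k +F z *F v k) +F (t *F (A +F z *F B) +F (A' +F z *F B'))
      ≡⟨ solve 9 (λ c u z v t A B A' B' → c :* (u :+ z :* v) :+ (t :* (A :+ z :* B) :+ (A' :+ z :* B'))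
           := (c :* u :+ (t :* A :+ A')) :+ z :* (c :* v :+ (t :* B :+ B'))) refl c (u k) z (v k) t A B A' B' ⟩
    (c *F u k +F (t *F A +F A')) +F z *F (c *F v k +F (t *F B +F B')) ∎
    where
    A  = mulSeries t cs u k
    B  = mulSeries t cs v k
    A' = delay (mulSeries t cs u) k
    B' = delay (mulSeries t cs v) k

  incSeries-axpy : ∀ {l} t (cs : Vec 𝔽 l) u z v k →
    incSeries t cs (λ k → u k +F z *F v k) k ≡ incSeries t cs u k +F z *F incSeries t cs v k
  incSeries-axpy t [] u z v k = sym (0+0 refl (zeroʳ z))
  incSeries-axpy t (c ∷ cs) u z v k = begin
    t *F incSeries t cs (λ k → u k +F z *F v k) k +F delay (mulSeries t cs (λ k → u k +F z *F v k)) k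
      ≡⟨ cong₂ (λ x y → t *F x +F y) (incSeries-axpy t cs u z v k)
           (trans (delay-cong (mulSeries-axpy t cs u z v) k) (delay-axpy (mulSeries t cs u) z (mulSeries t cs v) k)) ⟩
    t *F (A +F z *F B) +F (A' +F z *F B')
      ≡⟨ solve 6 (λ z t A B A' B' → t :* (A :+ z :* B) :+ (A' :+ z :* B')
           := (t :* A :+ A') :+ z :* (t :* B :+ B')) refl z t A B A' B' ⟩
    (t *F A +F A') +F z *F (t *F B +F B') ∎
    where
    A  = incSeries t cs u k
    B  = incSeries t cs v k
    A' = delay (mulSeries t cs u) k
    B' = delay (mulSeries t cs v) k

  mulSeries-order : ∀ {l} t (cs : Vec 𝔽 l) u k → (∀ j → j ℕ.≤ k → u j ≡ 0F) → mulSeries t cs u k ≡ 0F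
  delay-mulSeries-order : ∀ {l} t (cs : Vec 𝔽 l) u k → (∀ j → j ℕ.< k → u j ≡ 0F) → delay (mulSeries t cs u) k ≡ 0F

  mulSeries-order t []       u k u≡0 = refl
  mulSeries-order t (c ∷ cs) u k u≡0 = 0+0 (*-zero c (u≡0 k ℕₚ.≤-refl))
    (0+0 (*-zero t (mulSeries-order t cs u k u≡0)) (delay-mulSeries-order t cs u k (λ j j<k → u≡0 j (ℕₚ.<⇒≤ j<k))))

  delay-mulSeries-order t cs u zero    u≡0 = refl
  delay-mulSeries-order t cs u (suc k) u≡0 = mulSeries-order t cs u k (λ j j≤k → u≡0 j (s≤s j≤k))

  -- cs(t + τ) - cs(t) is divisible by τ, so coefficient k of the product sees u only strictly below
  -- k. This is the gain of one order over `mulSeries-order`.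
  incSeries-order : ∀ {l} t (cs : Vec 𝔽 l) u k → (∀ j → j ℕ.< k → u j ≡ 0F) → incSeries t cs u k ≡ 0F
  incSeries-order t []       u k u≡0 = refl
  incSeries-order t (c ∷ cs) u k u≡0 = 0+0 (*-zero t (incSeries-order t cs u k u≡0)) (delay-mulSeries-order t cs u k u≡0)

  -- Q + z R
  axpy : ∀ {n D} → Poly n (suc D) → 𝔽 → Poly n D → Poly n (suc D)
  axpy Q         z none      = Q
  axpy (const c) z (const d) = const (c +F z *F d)
  axpy (Q +X· Q') z (R +X· R') = axpy Q z R +X· axpy Q' z R'

  -- Q + (X + z) R
  addMul : ∀ {n D} → 𝔽 → Poly n (suc D) → Poly (suc n) D → Poly (suc n) (suc D)
  addMul z Q none       = Q +X· none
  addMul z Q (R +X· R') = axpy Q z R +X· addMul z R R'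

  -- This is P(a + X), whose coefficients are the Hasse derivatives of P at a. Shifting by C(t)
  -- leaves only the increment of the curve to be substituted.
  shift : ∀ {n D} → Point q n → Poly n D → Poly n D
  shift a       none      = none
  shift []      (const c) = const c
  shift (z ∷ a) (P +X· Q) = addMul z (shift a P) (shift (z ∷ a) Q)

  module _ (t : 𝔽) {l : ℕ} where
    private
      Curve : ℕ → Set
      Curve = Vec (Vec 𝔽 l)

    taylorAlong : ∀ {n D} → Curve n → Vec ℕ n → Poly n D → Series
    taylorAlong = expand series (mulSeries t)

    taylorInc : ∀ {n D} → Curve n → Vec ℕ n → Poly n D → Series
    taylorInc = expand series (incSeries t)

    taylorInc-axpy : ∀ {n D} (C : Curve n) is (Q : Poly n (suc D)) z R k →
      taylorInc C is (axpy Q z R) k ≡ taylorInc C is Q k +F z *F taylorInc C is R k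
    taylorInc-axpy C is Q z none k = sym (trans (cong (taylorInc C is Q k +F_) (zeroʳ z)) (+-identityʳ _))
    taylorInc-axpy [] [] (const c) z (const d) zero    = refl
    taylorInc-axpy [] [] (const c) z (const d) (suc k) = sym (0+0 refl (zeroʳ z))
    taylorInc-axpy (e ∷ C) (zero ∷ is) (Q +X· Q') z (R +X· R') k = begin
      taylorInc C is (axpy Q z R) k +F incSeries t e (taylorInc (e ∷ C) (0 ∷ is) (axpy Q' z R')) k
        ≡⟨ cong₂ _+F_ (taylorInc-axpy C is Q z R k)
             (trans (incSeries-cong t e (taylorInc-axpy (e ∷ C) (0 ∷ is) Q' z R') k)
                    (incSeries-axpy t e (taylorInc (e ∷ C) (0 ∷ is) Q') z (taylorInc (e ∷ C) (0 ∷ is) R') k)) ⟩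
      (x +F z *F y) +F (x' +F z *F y')
        ≡⟨ solve 5 (λ z x y x' y' → (x :+ z :* y) :+ (x' :+ z :* y') := (x :+ x') :+ z :* (y :+ y')) refl z x y x' y' ⟩
      (x +F x') +F z *F (y +F y') ∎
      where
      x  = taylorInc C is Q k
      y  = taylorInc C is R k
      x' = incSeries t e (taylorInc (e ∷ C) (0 ∷ is) Q') k
      y' = incSeries t e (taylorInc (e ∷ C) (0 ∷ is) R') k
    taylorInc-axpy (e ∷ C) (suc j ∷ is) (Q +X· Q') z (R +X· R') k = begin
      incSeries t e (taylorInc (e ∷ C) (suc j ∷ is) (axpy Q' z R')) k +F taylorInc (e ∷ C) (j ∷ is) (axpy Q' z R') k
        ≡⟨ cong₂ _+F_
             (trans (incSeries-cong t e (taylorInc-axpy (e ∷ C) (suc j ∷ is) Q' z R') k)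
                    (incSeries-axpy t e (taylorInc (e ∷ C) (suc j ∷ is) Q') z (taylorInc (e ∷ C) (suc j ∷ is) R') k))
             (taylorInc-axpy (e ∷ C) (j ∷ is) Q' z R' k) ⟩
      (x' +F z *F y') +F (x +F z *F y)
        ≡⟨ solve 5 (λ z x y x' y' → (x' :+ z :* y') :+ (x :+ z :* y) := (x' :+ x) :+ z :* (y' :+ y)) refl z x y x' y' ⟩
      (x' +F x) +F z *F (y' +F y) ∎
      where
      x  = taylorInc (e ∷ C) (j ∷ is) Q' k
      y  = taylorInc (e ∷ C) (j ∷ is) R' k
      x' = incSeries t e (taylorInc (e ∷ C) (suc j ∷ is) Q') k
      y' = incSeries t e (taylorInc (e ∷ C) (suc j ∷ is) R') k

    -- X stands for the increment plus Y in the first coordinate, so the factor X + z contributes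
    -- increment, z and Y. The Y part appears only for a positive first exponent, where in turn Q,
    -- being free of X, drops out.
    taylorInc-addMul₀ : ∀ {n D} e (C : Curve n) is z (Q : Poly n (suc D)) R k →
      taylorInc (e ∷ C) (0 ∷ is) (addMul z Q R) k ≡
      taylorInc C is Q k +F (incSeries t e (taylorInc (e ∷ C) (0 ∷ is) R) k +F z *F taylorInc (e ∷ C) (0 ∷ is) R k)
    taylorInc-addMul : ∀ {n D} e (C : Curve n) j is z (Q : Poly n (suc D)) R k →
      taylorInc (e ∷ C) (suc j ∷ is) (addMul z Q R) k ≡
      (incSeries t e (taylorInc (e ∷ C) (suc j ∷ is) R) k +F z *F taylorInc (e ∷ C) (suc j ∷ is) R k)
        +F taylorInc (e ∷ C) (j ∷ is) R k
    -- R + (X + z) R' = (R + X R') + z R'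
    taylorInc-addMul-tail : ∀ {n D} e (C : Curve n) j is z (R : Poly n (suc D)) R' k →
      taylorInc (e ∷ C) (j ∷ is) (addMul z R R') k ≡
      taylorInc (e ∷ C) (j ∷ is) (R +X· R') k +F z *F taylorInc (e ∷ C) (j ∷ is) R' k

    taylorInc-addMul-tail e C zero    is z R R' k = trans (taylorInc-addMul₀ e C is z R R' k) (sym (+-assoc _ _ _))
    taylorInc-addMul-tail e C (suc j) is z R R' k = trans (taylorInc-addMul e C j is z R R' k)
      (solve 3 (λ x y w → (x :+ y) :+ w := (x :+ w) :+ y) refl _ _ _)

    taylorInc-addMul₀ e C is z Q none k = cong (taylorInc C is Q k +F_)
      (sym (trans (cong (incSeries t e (λ _ → 0F) k +F_) (zeroʳ z)) (+-identityʳ _)))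
    taylorInc-addMul₀ e C is z Q (R +X· R') k = begin
      taylorInc C is (axpy Q z R) k +F incSeries t e (taylorInc (e ∷ C) (0 ∷ is) (addMul z R R')) k
        ≡⟨ cong₂ _+F_ (taylorInc-axpy C is Q z R k)
             (trans (incSeries-cong t e (taylorInc-addMul-tail e C 0 is z R R') k)
                    (incSeries-axpy t e (taylorInc (e ∷ C) (0 ∷ is) (R +X· R')) z (taylorInc (e ∷ C) (0 ∷ is) R') k)) ⟩
      (a +F z *F b) +F (c +F z *F d)
        ≡⟨ solve 5 (λ a b c d z → (a :+ z :* b) :+ (c :+ z :* d) := a :+ (c :+ z :* (b :+ d))) refl a b c d z ⟩
      a +F (c +F z *F (b +F d)) ∎
      where
      a = taylorInc C is Q k
      b = taylorInc C is R k
      c = incSeries t e (taylorInc (e ∷ C) (0 ∷ is) (R +X· R')) k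
      d = incSeries t e (taylorInc (e ∷ C) (0 ∷ is) R') k

    taylorInc-addMul e C j is z Q none k =
      cong (_+F 0F) (sym (trans (cong (incSeries t e (λ _ → 0F) k +F_) (zeroʳ z)) (+-identityʳ _)))
    taylorInc-addMul e C j is z Q (R +X· R') k = begin
      incSeries t e (taylorInc (e ∷ C) (suc j ∷ is) (addMul z R R')) k +F taylorInc (e ∷ C) (j ∷ is) (addMul z R R') k
        ≡⟨ cong₂ _+F_
             (trans (incSeries-cong t e (taylorInc-addMul-tail e C (suc j) is z R R') k)
                    (incSeries-axpy t e (taylorInc (e ∷ C) (suc j ∷ is) (R +X· R')) z (taylorInc (e ∷ C) (suc j ∷ is) R') k))
             (taylorInc-addMul-tail e C j is z R R' k) ⟩
      (c +F z *F d) +F (a +F z *F b)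
        ≡⟨ solve 5 (λ a b c d z → (c :+ z :* d) :+ (a :+ z :* b) := (c :+ z :* (d :+ b)) :+ a) refl a b c d z ⟩
      (c +F z *F (d +F b)) +F a ∎
      where
      a = taylorInc (e ∷ C) (j ∷ is) (R +X· R') k
      b = taylorInc (e ∷ C) (j ∷ is) R' k
      c = incSeries t e (taylorInc (e ∷ C) (suc j ∷ is) (R +X· R')) k
      d = incSeries t e (taylorInc (e ∷ C) (suc j ∷ is) R') k

    evalCurve : ∀ {n} → Curve n → Point q n
    evalCurve = Vec.map (λ cs → evalPoly F cs t)

    -- P(C(t + τ) + Y) is P(C(t) + X) evaluated at X = (C(t + τ) - C(t)) + Y.
    taylorAlong-shift : ∀ {n D} (C : Curve n) is (P : Poly n D) k →
      taylorAlong C is P k ≡ taylorInc C is (shift (evalCurve C) P) k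
    private
      tail-shift : ∀ {n D} e (C : Curve n) j is (Q : Poly (suc n) D) k →
        mulSeries t e (taylorAlong (e ∷ C) (j ∷ is) Q) k ≡
        incSeries t e (taylorInc (e ∷ C) (j ∷ is) (shift (evalCurve (e ∷ C)) Q)) k
          +F evalPoly F e t *F taylorInc (e ∷ C) (j ∷ is) (shift (evalCurve (e ∷ C)) Q) k

    taylorAlong-shift C is none k = refl
    taylorAlong-shift [] [] (const c) k = refl
    taylorAlong-shift (e ∷ C) (zero ∷ is) (P +X· Q) k =
      trans (cong₂ _+F_ (taylorAlong-shift C is P k) (tail-shift e C 0 is Q k))
            (sym (taylorInc-addMul₀ e C is (evalPoly F e t) (shift (evalCurve C) P) (shift (evalCurve (e ∷ C)) Q) k))
    taylorAlong-shift (e ∷ C) (suc j ∷ is) (P +X· Q) k =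
      trans (cong₂ _+F_ (tail-shift e C (suc j) is Q k) (taylorAlong-shift (e ∷ C) (j ∷ is) Q k))
            (sym (taylorInc-addMul e C j is (evalPoly F e t) (shift (evalCurve C) P) (shift (evalCurve (e ∷ C)) Q) k))

    tail-shift e C j is Q k =
      trans (mulSeries-cong t e (taylorAlong-shift (e ∷ C) (j ∷ is) Q) k) (mulSeries-inc t e _ k)

    -- The coefficients of P; the curve is a dummy, its increments being replaced by their value 0 at τ = 0.
    coefficient : ∀ {n D} → Curve n → Vec ℕ n → Poly n D → 𝔽
    coefficient = expand scalars (λ _ _ → 0F)

    coefficient-tail : ∀ {n D} e (C : Curve n) m (P : Poly n (suc D)) Q →
      (∀ is → Vec.sum is ℕ.< suc m → coefficient (e ∷ C) is (P +X· Q) ≡ 0F) →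
      ∀ is → Vec.sum is ℕ.< m → coefficient (e ∷ C) is Q ≡ 0F
    coefficient-tail e C m P Q PQ≡0 (j ∷ is) <m = trans (sym (+-identityˡ _)) (PQ≡0 (suc j ∷ is) (s≤s <m))

    -- Only monomials of degree at least m survive in P, and each variable is replaced by something
    -- of order at least one in τ and Y together. In the recursion, every factor X uses up one unit
    -- of m.
    taylorInc-order : ∀ {n D} (C : Curve n) m (P : Poly n D) →
      (∀ is → Vec.sum is ℕ.< m → coefficient C is P ≡ 0F) →
      ∀ is k → Vec.sum is ℕ.+ k ℕ.< m → taylorInc C is P k ≡ 0F
    taylorInc-order C m none P≡0 is k <m = refl
    taylorInc-order [] m (const c) P≡0 [] zero    <m = P≡0 [] <m
    taylorInc-order [] m (const c) P≡0 [] (suc k) <m = refl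
    taylorInc-order (e ∷ C) (suc m) (P +X· Q) PQ≡0 (zero ∷ is) k <m = 0+0
      (taylorInc-order C (suc m) P (λ is <m → trans (sym (+-identityʳ _)) (PQ≡0 (0 ∷ is) <m)) is k <m)
      (incSeries-order t e _ k (λ j j<k → taylorInc-order (e ∷ C) m Q (coefficient-tail e C m P Q PQ≡0) (0 ∷ is) j
        (ℕₚ.<-≤-trans (ℕₚ.+-monoʳ-< (Vec.sum is) j<k) (ℕ.s≤s⁻¹ <m))))
    taylorInc-order (e ∷ C) (suc m) (P +X· Q) PQ≡0 (suc j ∷ is) k (s≤s <m) = 0+0
      (incSeries-order t e _ k (λ l l<k → taylorInc-order (e ∷ C) m Q (coefficient-tail e C m P Q PQ≡0) (suc j ∷ is) l
        (ℕₚ.<-≤-trans (s≤s (ℕₚ.+-monoʳ-< (j ℕ.+ Vec.sum is) l<k)) <m)))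
      (taylorInc-order (e ∷ C) m Q (coefficient-tail e C m P Q PQ≡0) (j ∷ is) k <m)

    taylorInc₀ : ∀ {n D} (C : Curve n) is (P : Poly n D) → taylorInc C is P 0 ≡ coefficient C is P
    taylorInc₀ = expand-rel series scalars (incSeries t) (λ _ _ → 0F) (λ u x → u 0 ≡ x) refl (λ c → refl)
      (cong₂ _+F_) (λ e _ → incSeries-order t e _ 0 (λ j ()))

    taylorAlong₀ : ∀ {n D} (C : Curve n) is (P : Poly n D) → taylorAlong C is P 0 ≡ hasse (evalCurve C) is P
    taylorAlong₀ C is P = trans
      (expand-rel series scalars (mulSeries t) (λ cs → evalPoly F cs t *F_) (λ u x → u 0 ≡ x) refl (λ c → refl)
        (cong₂ _+F_)
        (λ { e {u} refl → trans (mulSeries-inc t e u 0)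
               (trans (cong (_+F evalPoly F e t *F u 0) (incSeries-order t e u 0 (λ j ()))) (+-identityˡ _)) })
        C is P)
      (expand-map scalars _*F_ (λ cs → evalPoly F cs t) C is P)

    taylorAlong-order : ∀ {n D} (C : Curve n) m (P : Poly n D) →
      (∀ is → Vec.sum is ℕ.< m → hasse (evalCurve C) is P ≡ 0F) →
      ∀ is k → Vec.sum is ℕ.+ k ℕ.< m → taylorAlong C is P k ≡ 0F
    taylorAlong-order C m P P≡0 is k <m = trans (taylorAlong-shift C is P k)
      (taylorInc-order C m (shift (evalCurve C) P)
        -- Comparing both sides of `taylorAlong-shift` at τ = 0 identifies the coefficients of the
        -- shifted polynomial with the Hasse derivatives of P at C(t).
        (λ is <m → trans (sym (taylorInc₀ C is (shift (evalCurve C) P)))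
           (trans (sym (taylorAlong-shift C is P 0)) (trans (taylorAlong₀ C is P) (P≡0 is <m)))) is k <m)

  -- Restricting a polynomial to a curve: Taylor coefficients and degree

  taylor-⊞ : ∀ t u v k → taylor t k (u ⊞ v) ≡ taylor t k u +F taylor t k v
  taylor-⊞ t [] v k = sym (+-identityˡ _)
  taylor-⊞ t (x ∷ u) [] k = sym (+-identityʳ _)
  taylor-⊞ t (x ∷ u) (y ∷ v) zero = trans (cong (λ w → (x +F y) +F t *F w) (taylor-⊞ t u v 0))
    (solve 5 (λ x y t a b → (x :+ y) :+ t :* (a :+ b) := (x :+ t :* a) :+ (y :+ t :* b)) refl x y t _ _)
  taylor-⊞ t (x ∷ u) (y ∷ v) (suc k) = trans (cong₂ (λ w w' → t *F w +F w') (taylor-⊞ t u v (suc k)) (taylor-⊞ t u v k))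
    (solve 5 (λ t a b c d → t :* (a :+ b) :+ (c :+ d) := (t :* a :+ c) :+ (t :* b :+ d)) refl t _ _ _ _)

  taylor-scale : ∀ t c u k → taylor t k (map (c *F_) u) ≡ c *F taylor t k u
  taylor-scale t c [] k = sym (zeroʳ c)
  taylor-scale t c (x ∷ u) zero = trans (cong (λ w → c *F x +F t *F w) (taylor-scale t c u 0))
    (solve 4 (λ c x t a → c :* x :+ t :* (c :* a) := c :* (x :+ t :* a)) refl c x t _)
  taylor-scale t c (x ∷ u) (suc k) = trans (cong₂ (λ w w' → t *F w +F w') (taylor-scale t c u (suc k)) (taylor-scale t c u k))
    (solve 4 (λ c t a b → t :* (c :* a) :+ c :* b := c :* (t :* a :+ b)) refl c t _ _)

  taylor-timesX : ∀ t u k → taylor t k (timesX u) ≡ t *F taylor t k u +F delay (λ k → taylor t k u) k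
  taylor-timesX t [] zero    = sym (0+0 (zeroʳ t) refl)
  taylor-timesX t [] (suc k) = sym (0+0 (zeroʳ t) refl)
  taylor-timesX t (x ∷ u) zero    = +-comm _ _
  taylor-timesX t (x ∷ u) (suc k) = refl

  taylor-mulUnivariate : ∀ t {k} (cs : Vec 𝔽 k) u v → (∀ k → taylor t k u ≡ v k) →
    ∀ k → taylor t k (mulUnivariate cs u) ≡ mulSeries t cs v k
  taylor-mulUnivariate t [] u v u≡v k = refl
  taylor-mulUnivariate t (c ∷ cs) u v u≡v k = trans (taylor-⊞ t (map (c *F_) u) (timesX (mulUnivariate cs u)) k)
    (cong₂ _+F_ (trans (taylor-scale t c u k) (cong (c *F_) (u≡v k)))
      (trans (taylor-timesX t (mulUnivariate cs u) k)
        (cong₂ _+F_ (cong (t *F_) (taylor-mulUnivariate t cs u v u≡v k))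
                    (delay-cong (taylor-mulUnivariate t cs u v u≡v) k))))

  alongCurve : ∀ {l n D} → Vec (Vec 𝔽 l) n → Vec ℕ n → Poly n D → List 𝔽
  alongCurve = expand univariate mulUnivariate

  -- The list form controls the degree, the series form the order at t; `roots-bound` needs both for
  -- the same polynomial.
  taylor-alongCurve : ∀ t {l n D} (C : Vec (Vec 𝔽 l) n) is (P : Poly n D) k →
    taylor t k (alongCurve C is P) ≡ taylorAlong t C is P k
  taylor-alongCurve t = expand-rel univariate series mulUnivariate (mulSeries t) (λ u v → ∀ k → taylor t k u ≡ v k)
    (λ k → refl)
    (λ { c zero → trans (cong (c +F_) (zeroʳ t)) (+-identityʳ c) ; c (suc k) → 0+0 (zeroʳ t) refl })
    (λ {u} {u'} u≡v u'≡v' k → trans (taylor-⊞ t u u' k) (cong₂ _+F_ (u≡v k) (u'≡v' k)))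
    (λ cs {u} {v} u≡v → taylor-mulUnivariate t cs u v u≡v)

  -- Λ (e − 1) + 1, the number of coefficients of a polynomial of degree Λ (e − 1); zero polynomials have none.
  composedLength : ℕ → ℕ → ℕ
  composedLength Λ zero    = 0
  composedLength Λ (suc e) = suc (Λ ℕ.* e)

  length-⊞ : ∀ u v {b} → length u ℕ.≤ b → length v ℕ.≤ b → length (u ⊞ v) ℕ.≤ b
  length-⊞ []      v       u≤ v≤ = v≤
  length-⊞ (x ∷ u) []      u≤ v≤ = u≤
  length-⊞ (x ∷ u) (y ∷ v) (s≤s u≤) (s≤s v≤) = s≤s (length-⊞ u v u≤ v≤)

  length-timesX : ∀ u {b} → length u ℕ.≤ b → length (timesX u) ℕ.≤ suc b
  length-timesX []      u≤ = z≤n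
  length-timesX (x ∷ u) u≤ = s≤s u≤

  length-scale : ∀ c (u : List 𝔽) → length (map (c *F_) u) ≡ length u
  length-scale c []      = refl
  length-scale c (x ∷ u) = cong suc (length-scale c u)

  mulUnivariate-[] : ∀ {l} (cs : Vec 𝔽 l) → mulUnivariate cs [] ≡ []
  mulUnivariate-[] []       = refl
  mulUnivariate-[] (c ∷ cs) = cong timesX (mulUnivariate-[] cs)

  length-mulUnivariate : ∀ {Λ} (cs : Vec 𝔽 (suc Λ)) u {b} → length u ℕ.≤ b → length (mulUnivariate cs u) ℕ.≤ Λ ℕ.+ b
  length-mulUnivariate {zero} (c ∷ []) u u≤ = length-⊞ (map (c *F_) u) [] (subst (ℕ._≤ _) (sym (length-scale c u)) u≤) z≤n
  length-mulUnivariate {suc Λ} (c ∷ cs) u {b} u≤ = length-⊞ (map (c *F_) u) (timesX (mulUnivariate cs u))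
    (subst (ℕ._≤ _) (sym (length-scale c u)) (ℕₚ.≤-trans u≤ (ℕₚ.m≤n+m b (suc Λ))))
    (length-timesX (mulUnivariate cs u) (length-mulUnivariate cs u u≤))

  -- Put e = D - w. A nonempty u forces e ≥ 1, and then Λ + (Λ(e - 1) + 1) = Λe + 1. An empty u
  -- stays empty.
  composedLength-mul : ∀ {Λ} (cs : Vec 𝔽 (suc Λ)) u D w → length u ℕ.≤ composedLength Λ (D ℕ.∸ w) →
    length (mulUnivariate cs u) ℕ.≤ composedLength Λ (suc D ℕ.∸ w)
  composedLength-mul {Λ} cs [] D w u≤ rewrite mulUnivariate-[] cs = z≤n
  composedLength-mul {Λ} cs u@(_ ∷ _) D w u≤ with w ℕ.≤? D
  ... | no w≰D with () ← subst (λ e → length u ℕ.≤ composedLength Λ e) (ℕₚ.m≤n⇒m∸n≡0 (ℕₚ.<⇒≤ (ℕₚ.≰⇒> w≰D))) u≤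
  ... | yes w≤D rewrite ℕₚ.+-∸-assoc 1 w≤D with D ℕ.∸ w
  ... | suc e = ℕₚ.≤-trans (length-mulUnivariate cs u u≤)
    (ℕₚ.≤-reflexive (trans (ℕₚ.+-suc Λ (Λ ℕ.* e)) (cong suc (sym (ℕₚ.*-suc Λ e)))))

  length-alongCurve : ∀ {Λ n D} (C : Curve≤ q n Λ) is (P : Poly n D) →
    length (alongCurve C is P) ℕ.≤ composedLength Λ (D ℕ.∸ Vec.sum is)
  length-alongCurve C is none = z≤n
  length-alongCurve [] [] (const c) = s≤s z≤n
  length-alongCurve (e ∷ C) (zero ∷ is) (_+X·_ {D = D} P Q) = length-⊞ (alongCurve C is P) _ (length-alongCurve C is P)
    (composedLength-mul e (alongCurve (e ∷ C) (0 ∷ is) Q) D (Vec.sum is) (length-alongCurve (e ∷ C) (0 ∷ is) Q))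
  length-alongCurve {Λ} (e ∷ C) (suc j ∷ is) (_+X·_ {D = D} P Q) = length-⊞ (mulUnivariate e (alongCurve (e ∷ C) (suc j ∷ is) Q)) (alongCurve (e ∷ C) (j ∷ is) Q)
    (composedLength-mul e (alongCurve (e ∷ C) (suc j ∷ is) Q) D (suc j ℕ.+ Vec.sum is) (length-alongCurve (e ∷ C) (suc j ∷ is) Q))
    (length-alongCurve (e ∷ C) (j ∷ is) Q)

-- Vanishing with multiplicity

m<n∸o⇒m+o<n : ∀ {m n} o → m ℕ.< n ℕ.∸ o → m ℕ.+ o ℕ.< n
m<n∸o⇒m+o<n {m} {n} zero    m<        = subst (ℕ._< n) (sym (ℕₚ.+-identityʳ m)) m<
m<n∸o⇒m+o<n {m} {suc n} (suc o) m<    = subst (ℕ._< suc n) (sym (ℕₚ.+-suc m o)) (s≤s (m<n∸o⇒m+o<n o m<))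

-- Sums over lists and over all points

listSum : ∀ {A : Set} → (A → ℕ) → List A → ℕ
listSum f xs = sum (map f xs)

listSum-+ : ∀ {A : Set} (f g : A → ℕ) xs → listSum (λ x → f x ℕ.+ g x) xs ≡ listSum f xs ℕ.+ listSum g xs
listSum-+ f g []       = refl
listSum-+ f g (x ∷ xs) rewrite listSum-+ f g xs =
  solve 4 (λ a b c d → (a :+ b) :+ (c :+ d) := (a :+ c) :+ (b :+ d)) refl (f x) (g x) (listSum f xs) (listSum g xs)
  where open ℕ-Solver.+-*-Solver

listSum-*ˡ : ∀ {A : Set} c (f : A → ℕ) xs → listSum (λ x → c ℕ.* f x) xs ≡ c ℕ.* listSum f xs
listSum-*ˡ c f []       = sym (ℕₚ.*-zeroʳ c)
listSum-*ˡ c f (x ∷ xs) = trans (cong (c ℕ.* f x ℕ.+_) (listSum-*ˡ c f xs)) (sym (ℕₚ.*-distribˡ-+ c (f x) (listSum f xs)))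

listSum-const : ∀ {A : Set} c (xs : List A) → listSum (λ _ → c) xs ≡ c ℕ.* length xs
listSum-const c []       = sym (ℕₚ.*-zeroʳ c)
listSum-const c (x ∷ xs) = trans (cong (c ℕ.+_) (listSum-const c xs)) (sym (ℕₚ.*-suc c (length xs)))

listSum-mono : ∀ {A : Set} {f g : A → ℕ} → (∀ x → f x ℕ.≤ g x) → ∀ xs → listSum f xs ℕ.≤ listSum g xs
listSum-mono f≤g []       = z≤n
listSum-mono f≤g (x ∷ xs) = ℕₚ.+-mono-≤ (f≤g x) (listSum-mono f≤g xs)

listSum-++ : ∀ {A : Set} (f : A → ℕ) xs ys → listSum f (xs ++ ys) ≡ listSum f xs ℕ.+ listSum f ys
listSum-++ f xs ys = trans (cong sum (map-++ f xs ys)) (sum-++ (map f xs) (map f ys))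

listSum-swap : ∀ {A B : Set} (f : A → B → ℕ) xs ys →
  listSum (λ x → listSum (f x) ys) xs ≡ listSum (λ y → listSum (λ x → f x y) xs) ys
listSum-swap f []       ys = sym (listSum-const 0 ys)
listSum-swap f (x ∷ xs) ys = trans (cong (listSum (f x) ys ℕ.+_) (listSum-swap f xs ys))
  (sym (listSum-+ (f x) (λ y → listSum (λ x → f x y) xs) ys))

listSum-concatMap : ∀ {A B : Set} (f : B → ℕ) (g : A → List B) xs →
  listSum f (concatMap g xs) ≡ listSum (λ x → listSum f (g x)) xs
listSum-concatMap f g []       = refl
listSum-concatMap f g (x ∷ xs) = trans (listSum-++ f (g x) (concatMap g xs)) (cong (listSum f (g x) ℕ.+_) (listSum-concatMap f g xs))

listSum-cong : ∀ {A : Set} {f g : A → ℕ} → (∀ x → f x ≡ g x) → ∀ xs → listSum f xs ≡ listSum g xs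
listSum-cong f≡g []       = refl
listSum-cong f≡g (x ∷ xs) = cong₂ ℕ._+_ (f≡g x) (listSum-cong f≡g xs)

listSum-allFin : ∀ {n} (f : Fin n → ℕ) → listSum f (allFin n) ≡ sumFin f
listSum-allFin {n} f = trans (cong sum (map-tabulate (λ x → x) f)) (go f)
  where
  go : ∀ {n} (f : Fin n → ℕ) → sum (List.tabulate f) ≡ sumFin f
  go {zero}  f = refl
  go {suc n} f = cong (f zero ℕ.+_) (go (f ∘ suc))

length-concatMap : ∀ {A B : Set} (g : A → List B) xs → length (concatMap g xs) ≡ listSum (length ∘ g) xs
length-concatMap g []       = refl
length-concatMap g (x ∷ xs) = trans (length-++ (g x)) (cong (length (g x) ℕ.+_) (length-concatMap g xs))

listSum-points : ∀ {q n} (ν : Point q (suc n) → ℕ) →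
  listSum ν (allPoints q (suc n)) ≡ listSum (λ z → listSum (λ a → ν (z ∷ a)) (allPoints q n)) (allFin q)
listSum-points {q} {n} ν = trans (listSum-concatMap ν (λ a → map (a ∷_) (allPoints q n)) (allFin q))
  (listSum-cong (λ z → cong sum (sym (map-∘ (allPoints q n)))) (allFin q))

length-allPoints : ∀ q n → length (allPoints q n) ≡ q ℕ.^ n
length-allPoints q zero    = refl
length-allPoints q (suc n) = begin
  length (concatMap (λ a → map (a ∷_) (allPoints q n)) (allFin q))   ≡⟨ length-concatMap _ (allFin q) ⟩
  listSum (λ a → length (map (a ∷_) (allPoints q n))) (allFin q)     ≡⟨ listSum-cong (λ a → trans (length-map (a ∷_) (allPoints q n)) (length-allPoints q n)) (allFin q) ⟩
  listSum (λ _ → q ℕ.^ n) (allFin q)                                 ≡⟨ listSum-const (q ℕ.^ n) (allFin q) ⟩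
  q ℕ.^ n ℕ.* length (allFin q)                                      ≡⟨ cong (q ℕ.^ n ℕ.*_) (length-tabulate {n = q} (λ x → x)) ⟩
  q ℕ.^ n ℕ.* q                                                      ≡⟨ ℕₚ.*-comm (q ℕ.^ n) q ⟩
  q ℕ.* q ℕ.^ n                                                      ∎
  where open ≡-Reasoning

∈-allPoints : ∀ {q n} (a : Point q n) → a ∈ allPoints q n
∈-allPoints []      = here refl
∈-allPoints {q} {suc n} (z ∷ a) = ∈-concatMap⁺ (λ a → map (a ∷_) (allPoints q n)) (lose (∈-allFin z) (∈-map⁺ (z ∷_) (∈-allPoints a)))

countTrue-* : ∀ {A : Set} c (S : A → Bool) xs → listSum (λ x → if S x then c else 0) xs ≡ c ℕ.* countTrue S xs
countTrue-* c S xs = trans (listSum-cong pointwise xs) (listSum-*ˡ c (λ x → if S x then 1 else 0) xs)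
  where
  pointwise : ∀ x → (if S x then c else 0) ≡ c ℕ.* (if S x then 1 else 0)
  pointwise x with S x
  ... | true  = sym (ℕₚ.*-identityʳ c)
  ... | false = sym (ℕₚ.*-zeroʳ c)

-- The induction step of `schwartz-zippel`: t is the degree in the first variable, M the total
-- multiplicity of the leading coefficient, D the degree bound of the latter, and Q = q^n.
multiplicity-step : ∀ q t Q M D → q ℕ.* M ℕ.+ Q ℕ.≤ D ℕ.* Q →
  q ℕ.* (t ℕ.* Q ℕ.+ q ℕ.* M) ℕ.+ q ℕ.* Q ℕ.≤ (t ℕ.+ D) ℕ.* (q ℕ.* Q)
multiplicity-step q t Q M D ≤DQ = begin
  q ℕ.* (t ℕ.* Q ℕ.+ q ℕ.* M) ℕ.+ q ℕ.* Q   ≡⟨ solve 4 (λ q t Q M → q :* (t :* Q :+ q :* M) :+ q :* Q := q :* (t :* Q :+ (q :* M :+ Q))) refl q t Q M ⟩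
  q ℕ.* (t ℕ.* Q ℕ.+ (q ℕ.* M ℕ.+ Q))       ≤⟨ ℕₚ.*-monoʳ-≤ q (ℕₚ.+-monoʳ-≤ (t ℕ.* Q) ≤DQ) ⟩
  q ℕ.* (t ℕ.* Q ℕ.+ D ℕ.* Q)               ≡⟨ solve 4 (λ q t Q D → q :* (t :* Q :+ D :* Q) := (t :+ D) :* (q :* Q)) refl q t Q D ⟩
  (t ℕ.+ D) ℕ.* (q ℕ.* Q)                   ∎
  where
  open ℕₚ.≤-Reasoning
  open ℕ-Solver.+-*-Solver

-- The number of monomials of degree < D in n variables.
dim : ℕ → ℕ → ℕ
dim n       zero    = 0
dim zero    (suc D) = 1
dim (suc n) (suc D) = dim n (suc D) ℕ.+ dim (suc n) D

bumpHead : ∀ {n} → Vec ℕ (suc n) → Vec ℕ (suc n)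
bumpHead (j ∷ is) = suc j ∷ is

indices : (n m : ℕ) → List (Vec ℕ n)
indices n       zero    = []
indices zero    (suc m) = [] ∷ []
indices (suc n) (suc m) = map (0 ∷_) (indices n (suc m)) ++ map bumpHead (indices (suc n) m)

length-indices : ∀ n m → length (indices n m) ≡ dim n m
length-indices n       zero    = refl
length-indices zero    (suc m) = refl
length-indices (suc n) (suc m) = trans (length-++ (map (0 ∷_) (indices n (suc m))))
  (cong₂ ℕ._+_ (trans (length-map (0 ∷_) (indices n (suc m))) (length-indices n (suc m)))
               (trans (length-map bumpHead (indices (suc n) m)) (length-indices (suc n) m)))

∈-indices : ∀ {n} m (is : Vec ℕ n) → Vec.sum is ℕ.< m → is ∈ indices n m
∈-indices (suc m) []           <m       = here refl
∈-indices (suc m) (zero  ∷ is) <m       = ∈-++⁺ˡ (∈-map⁺ (0 ∷_) (∈-indices (suc m) is <m))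
∈-indices {suc n} (suc m) (suc j ∷ is) (s≤s <m) = ∈-++⁺ʳ (map (0 ∷_) (indices n (suc m))) (∈-map⁺ bumpHead (∈-indices m (j ∷ is) <m))

module Vanishing {q : ℕ} (F : FiniteField q) where
  open Field F
  open Multivariate F

  IsZero : ∀ {n D} → Poly n D → Set
  IsZero none      = ⊤
  IsZero (const c) = c ≡ 0F
  IsZero (P +X· Q) = IsZero P × IsZero Q

  isZero? : ∀ {n D} (P : Poly n D) → Dec (IsZero P)
  isZero? none      = yes tt
  isZero? (const c) = c ≟F 0F
  isZero? (P +X· Q) = isZero? P ×-dec isZero? Q

  hasse-zero : ∀ {n D} (a : Point q n) is (P : Poly n D) → IsZero P → hasse a is P ≡ 0F
  hasse-zero a       is           none      P≡0 = refl
  hasse-zero []      []           (const c) P≡0 = P≡0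
  hasse-zero (z ∷ a) (zero  ∷ is) (P +X· Q) (P≡0 , Q≡0) =
    0+0 (hasse-zero a is P P≡0) (*-zero z (hasse-zero (z ∷ a) (0 ∷ is) Q Q≡0))
  hasse-zero (z ∷ a) (suc j ∷ is) (P +X· Q) (P≡0 , Q≡0) =
    0+0 (*-zero z (hasse-zero (z ∷ a) (suc j ∷ is) Q Q≡0)) (hasse-zero (z ∷ a) (j ∷ is) Q Q≡0)

  -- The leading coefficient L of P in its first variable X, with t = deg_X P.  For every a and i, the
  -- slice g is the coefficient of Y^i in P(X, a + Y).
  record Leading {n D} (P : Poly (suc n) D) : Set where
    field
      {t D'}   : ℕ
      L        : Poly n D'
      degree   : t ℕ.+ D' ≡ D
      nonzero  : ¬ IsZero L
      slice    : Point q n → Vec ℕ n → List 𝔽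
      length≤  : ∀ a is → length (slice a is) ℕ.≤ suc t
      hasse≡   : ∀ a is z j → hasse (z ∷ a) (j ∷ is) P ≡ taylor z j (slice a is)
      leads    : ∀ a is → All (_≡ 0F) (slice a is) → hasse a is L ≡ 0F

  -- Constant terms in X are stripped off until the rest is zero; the last one is L. Each earlier
  -- one accounts for a power of X, lowers the degree bound of L by one and adds one entry to every
  -- slice.
  leading : ∀ {n D} (P : Poly (suc n) D) → ¬ IsZero P → Leading P
  leading none      P≢0 = ⊥-elim (P≢0 tt)
  leading (P +X· Q) P≢0 with isZero? Q
  ... | yes Q≡0 = record
    { t = 0 ; L = P ; degree = refl ; nonzero = λ P≡0 → P≢0 (P≡0 , Q≡0)
    ; slice = λ a is → hasse a is P ∷ [] ; length≤ = λ a is → s≤s z≤n ; hasse≡ = hasse≡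
    ; leads = λ { a is (P≡0 ∷ []) → P≡0 } }
    where
    hasse≡ : ∀ a is z j → hasse (z ∷ a) (j ∷ is) (P +X· Q) ≡ taylor z j (hasse a is P ∷ [])
    hasse≡ a is z zero    = cong (λ x → hasse a is P +F z *F x) (hasse-zero (z ∷ a) (0 ∷ is) Q Q≡0)
    hasse≡ a is z (suc j) = cong₂ (λ x y → z *F x +F y) (hasse-zero (z ∷ a) (suc j ∷ is) Q Q≡0) (hasse-zero (z ∷ a) (j ∷ is) Q Q≡0)
  ... | no Q≢0 = record
    { L = Lead.L ; degree = cong suc Lead.degree ; nonzero = Lead.nonzero
    ; slice = λ a is → hasse a is P ∷ Lead.slice a is ; length≤ = λ a is → s≤s (Lead.length≤ a is) ; hasse≡ = hasse≡
    ; leads = λ { a is (_ ∷ g≡0) → Lead.leads a is g≡0 } }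
    where
    module Lead = Leading (leading Q Q≢0)
    hasse≡ : ∀ a is z j → hasse (z ∷ a) (j ∷ is) (P +X· Q) ≡ taylor z j (hasse a is P ∷ Lead.slice a is)
    hasse≡ a is z zero    = cong (λ x → hasse a is P +F z *F x) (Lead.hasse≡ a is z 0)
    hasse≡ a is z (suc j) = cong₂ (λ x y → z *F x +F y) (Lead.hasse≡ a is z (suc j)) (Lead.hasse≡ a is z j)

  taylor-unique : ∀ z g → (∀ j → j ℕ.< length g → taylor z j g ≡ 0F) → All (_≡ 0F) g
  taylor-unique z g = go (length g) g refl
    where
    go : ∀ k g → length g ≡ k → (∀ j → j ℕ.< length g → taylor z j g ≡ 0F) → All (_≡ 0F) g
    go k       []      _    _   = []
    go (suc k) (c ∷ g) len≡ van = quotient-zero z c g (van 0 (s≤s z≤n))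
      (go k (quotient z g) (trans (length-quotient z g) (ℕₚ.suc-injective len≡))
        (λ j j< → trans (taylor-quotient z c g j) (van (suc j) (s≤s (subst (j ℕ.<_) (length-quotient z g) j<)))))

  -- By induction L has a nonzero Hasse derivative at a, of index i say. The slice at i is then a
  -- nonzero polynomial in X, so one of its Taylor coefficients at z is nonzero.
  nonvanishing : ∀ {n D} (P : Poly n D) → ¬ IsZero P → ∀ a → ∃ λ is → hasse a is P ≢ 0F
  nonvanishing {zero} none      P≢0 [] = ⊥-elim (P≢0 tt)
  nonvanishing {zero} (const c) P≢0 [] = [] , P≢0
  nonvanishing {suc n} P P≢0 (z ∷ a) with leading P P≢0
  ... | lead with nonvanishing (Leading.L lead) (Leading.nonzero lead) a
  ... | is , L≢0 with ℕₚ.anyUpTo? (λ j → ¬? (taylor z j (Leading.slice lead a is) ≟F 0F)) (length (Leading.slice lead a is))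
  ... | yes (j , _ , g≢0) = j ∷ is , g≢0 ∘ trans (sym (Leading.hasse≡ lead a is z j))
  ... | no all≡0 = ⊥-elim (L≢0 (Leading.leads lead a is (taylor-unique z _
          (λ j j< → decidable-stable (_ ≟F 0F) (λ g≢0 → all≡0 (j , j< , g≢0))))))

  VanishesTo : ∀ {n D} → Poly n D → ℕ → Point q n → Set
  VanishesTo P m a = ∀ is → Vec.sum is ℕ.< m → hasse a is P ≡ 0F

  -- Start from any nonzero Hasse derivative and pass to a lighter one while there is one; k bounds
  -- the weight and makes the descent terminate.
  exact-order : ∀ {n D} (P : Poly n D) → ¬ IsZero P → ∀ a →
    ∃ λ is → hasse a is P ≢ 0F × VanishesTo P (Vec.sum is) a
  exact-order {n} P P≢0 a with nonvanishing P P≢0 a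
  ... | is , Pa≢0 = descend (Vec.sum is) is ℕₚ.≤-refl Pa≢0
    where
    descend : ∀ k is → Vec.sum is ℕ.≤ k → hasse a is P ≢ 0F → ∃ λ is → hasse a is P ≢ 0F × VanishesTo P (Vec.sum is) a
    descend k is ≤k Pa≢0
      with any? (λ js → ¬? (hasse a js P ≟F 0F) ×-dec (Vec.sum js ℕ.<? Vec.sum is)) (indices n (Vec.sum is))
    ... | no none< = is , Pa≢0 , λ js js< → decidable-stable (hasse a js P ≟F 0F)
            (λ ≢0 → none< (lose (∈-indices _ js js<) (≢0 , js<)))
    ... | yes some< with find some<
    ... | js , _ , ≢0 , js< with k
    ... | zero  = ⊥-elim (ℕₚ.n≮0 (ℕₚ.<-≤-trans js< ≤k))
    ... | suc k = descend k js (ℕ.s≤s⁻¹ (ℕₚ.<-≤-trans js< ≤k)) ≢0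

  -- The Schwartz–Zippel lemma with multiplicities, Σ ν ≤ (D − 1) q^(n−1), multiplied by q so that it
  -- also makes sense for n = 0.
  schwartz-zippel : ∀ {n D} (P : Poly n D) → ¬ IsZero P → (ν : Point q n → ℕ) → (∀ a → VanishesTo P (ν a) a) →
    q ℕ.* listSum ν (allPoints q n) ℕ.+ q ℕ.^ n ℕ.≤ D ℕ.* q ℕ.^ n
  schwartz-zippel {zero} none P≢0 ν van = ⊥-elim (P≢0 tt)
  schwartz-zippel {zero} {suc D} (const c) P≢0 ν van with ν [] in eq
  ... | suc k = ⊥-elim (P≢0 (van [] [] (subst (0 ℕ.<_) (sym eq) (s≤s z≤n))))
  ... | zero rewrite ℕₚ.*-zeroʳ q = s≤s z≤n
  schwartz-zippel {suc n} {D} P P≢0 ν van = begin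
    q ℕ.* listSum ν (allPoints q (suc n)) ℕ.+ q ℕ.* Q          ≤⟨ ℕₚ.+-monoˡ-≤ _ (ℕₚ.*-monoʳ-≤ q sum-bound) ⟩
    q ℕ.* (t ℕ.* Q ℕ.+ q ℕ.* M) ℕ.+ q ℕ.* Q                    ≤⟨ multiplicity-step q t Q M D' (schwartz-zippel L nonzero μ (λ a → proj₂ (proj₂ (order a)))) ⟩
    (t ℕ.+ D') ℕ.* (q ℕ.* Q)                                   ≡⟨ cong (ℕ._* (q ℕ.* Q)) degree ⟩
    D ℕ.* (q ℕ.* Q)                                            ∎
    where
    open ℕₚ.≤-Reasoning
    open Leading (leading P P≢0)
    Q = q ℕ.^ n
    -- For each a this gives an index i of weight μ a, the exact order of L at a, at which the Hasse
    -- derivative of L is nonzero.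
    order = exact-order L nonzero
    μ : Point q n → ℕ
    μ a = Vec.sum (proj₁ (order a))
    M = listSum μ (allPoints q n)

    -- The slice at i has degree at most t and vanishes at z to order ν (z ∷ a) - μ a. More than t
    -- zeros would make it zero, and with it the Hasse derivative of L at i.
    excess : ∀ a → sumFin (λ z → ν (z ∷ a) ℕ.∸ μ a) ℕ.≤ t
    excess a with suc t ℕ.≤? sumFin (λ z → ν (z ∷ a) ℕ.∸ μ a)
    ... | no t≮ = ℕₚ.≮⇒≥ t≮
    ... | yes t< = ⊥-elim (proj₁ (proj₂ (order a)) (leads a i (roots-bound (slice a i) (λ z → ν (z ∷ a) ℕ.∸ μ a)
        (λ z j j< → trans (sym (hasse≡ a i z j)) (van (z ∷ a) (j ∷ i) (m<n∸o⇒m+o<n (μ a) j<)))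
        (ℕₚ.≤-trans (length≤ a i) t<))))
      where i = proj₁ (order a)

    fibre-bound : ∀ a → listSum (λ z → ν (z ∷ a)) (allFin q) ℕ.≤ t ℕ.+ q ℕ.* μ a
    fibre-bound a = begin
      listSum (λ z → ν (z ∷ a)) (allFin q)                              ≤⟨ listSum-mono (λ z → ℕₚ.m≤n+m∸n (ν (z ∷ a)) (μ a)) (allFin q) ⟩
      listSum (λ z → μ a ℕ.+ (ν (z ∷ a) ℕ.∸ μ a)) (allFin q)            ≡⟨ listSum-+ (λ _ → μ a) (λ z → ν (z ∷ a) ℕ.∸ μ a) (allFin q) ⟩
      listSum (λ _ → μ a) (allFin q) ℕ.+ listSum (λ z → ν (z ∷ a) ℕ.∸ μ a) (allFin q)
        ≡⟨ cong₂ ℕ._+_ (trans (listSum-const (μ a) (allFin q)) (cong (μ a ℕ.*_) (length-tabulate {n = q} (λ x → x)))) (listSum-allFin (λ z → ν (z ∷ a) ℕ.∸ μ a)) ⟩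
      μ a ℕ.* q ℕ.+ sumFin (λ z → ν (z ∷ a) ℕ.∸ μ a)                    ≤⟨ ℕₚ.+-monoʳ-≤ (μ a ℕ.* q) (excess a) ⟩
      μ a ℕ.* q ℕ.+ t                                                   ≡⟨ ℕₚ.+-comm (μ a ℕ.* q) t ⟩
      t ℕ.+ μ a ℕ.* q                                                   ≡⟨ cong (t ℕ.+_) (ℕₚ.*-comm (μ a) q) ⟩
      t ℕ.+ q ℕ.* μ a                                                   ∎

    sum-bound : listSum ν (allPoints q (suc n)) ℕ.≤ t ℕ.* Q ℕ.+ q ℕ.* M
    sum-bound = begin
      listSum ν (allPoints q (suc n))                                          ≡⟨ listSum-points ν ⟩
      listSum (λ z → listSum (λ a → ν (z ∷ a)) (allPoints q n)) (allFin q)      ≡⟨ listSum-swap (λ z a → ν (z ∷ a)) (allFin q) (allPoints q n) ⟩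
      listSum (λ a → listSum (λ z → ν (z ∷ a)) (allFin q)) (allPoints q n)      ≤⟨ listSum-mono fibre-bound (allPoints q n) ⟩
      listSum (λ a → t ℕ.+ q ℕ.* μ a) (allPoints q n)                           ≡⟨ listSum-+ (λ _ → t) (λ a → q ℕ.* μ a) (allPoints q n) ⟩
      listSum (λ _ → t) (allPoints q n) ℕ.+ listSum (λ a → q ℕ.* μ a) (allPoints q n)
        ≡⟨ cong₂ ℕ._+_ (trans (listSum-const t (allPoints q n)) (cong (t ℕ.*_) (length-allPoints q n))) (listSum-*ˡ q μ (allPoints q n)) ⟩
      t ℕ.* Q ℕ.+ q ℕ.* M ∎

  -- Polynomials with prescribed zeros, by counting

  _⊖_ : ∀ {n D} → Poly n D → Poly n D → Poly n D
  none      ⊖ none        = none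
  const c   ⊖ const d     = const (c +F (-F d))
  (P +X· Q) ⊖ (P' +X· Q') = (P ⊖ P') +X· (Q ⊖ Q')

  ⊖-zero : ∀ {n D} (P Q : Poly n D) → IsZero (P ⊖ Q) → P ≡ Q
  ⊖-zero none      none        z         = refl
  ⊖-zero (const c) (const d)   z         = cong const (x∙y⁻¹≈ε⇒x≈y c d z)
  ⊖-zero (P +X· Q) (P' +X· Q') (z , z')  = cong₂ _+X·_ (⊖-zero P P' z) (⊖-zero Q Q' z')

  -- Stated without subtraction so that it is preserved by semiring identities.
  hasse-⊖ : ∀ {n D} (a : Point q n) is (P Q : Poly n D) → hasse a is (P ⊖ Q) +F hasse a is Q ≡ hasse a is P
  hasse-⊖ a is none none = +-identityˡ 0F
  hasse-⊖ [] [] (const c) (const d) = trans (+-assoc c (-F d) d) (trans (cong (c +F_) (-‿inverseˡ d)) (+-identityʳ c))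
  hasse-⊖ (z ∷ a) (zero ∷ is) (P +X· Q) (P' +X· Q') = trans
    (solve 5 (λ z x y x' y' → (x :+ z :* y) :+ (x' :+ z :* y') := (x :+ x') :+ z :* (y :+ y')) refl z _ _ _ _)
    (cong₂ (λ u v → u +F z *F v) (hasse-⊖ a is P P') (hasse-⊖ (z ∷ a) (0 ∷ is) Q Q'))
  hasse-⊖ (z ∷ a) (suc j ∷ is) (P +X· Q) (P' +X· Q') = trans
    (solve 5 (λ z x y x' y' → (z :* y :+ x) :+ (z :* y' :+ x') := z :* (y :+ y') :+ (x :+ x')) refl z _ _ _ _)
    (cong₂ (λ u v → z *F v +F u) (hasse-⊖ (z ∷ a) (j ∷ is) Q Q') (hasse-⊖ (z ∷ a) (suc j ∷ is) Q Q'))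

  fromCoefficients : ∀ n D → (Fin (dim n D) → 𝔽) → Poly n D
  fromCoefficients n       zero    f = none
  fromCoefficients zero    (suc D) f = const (f zero)
  fromCoefficients (suc n) (suc D) f =
    fromCoefficients n (suc D) (λ k → f (k ↑ˡ dim (suc n) D)) +X· fromCoefficients (suc n) D (λ k → f (dim n (suc D) ↑ʳ k))

  +X·-injective : ∀ {n D} {P P' : Poly n (suc D)} {Q Q'} → P +X· Q ≡ P' +X· Q' → P ≡ P' × Q ≡ Q'
  +X·-injective refl = refl , refl

  const-injective : ∀ {D} {c d : 𝔽} → const {D = D} c ≡ const d → c ≡ d
  const-injective refl = refl

  fromCoefficients-injective : ∀ n D f g → fromCoefficients n D f ≡ fromCoefficients n D g → ∀ k → f k ≡ g k
  fromCoefficients-injective zero    (suc D) f g eq zero = const-injective eq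
  fromCoefficients-injective (suc n) (suc D) f g eq k with splitAt (dim n (suc D)) k in split
  ... | inj₁ j = subst (λ k → f k ≡ g k) (splitAt⁻¹-↑ˡ split) (fromCoefficients-injective n (suc D) _ _ (proj₁ (+X·-injective eq)) j)
  ... | inj₂ j = subst (λ k → f k ≡ g k) (splitAt⁻¹-↑ʳ split) (fromCoefficients-injective (suc n) D _ _ (proj₂ (+X·-injective eq)) j)

  1<q : 1 ℕ.< q
  1<q = go q 0F 1F 0≢1
    where
    go : ∀ q (x y : Fin q) → x ≢ y → 1 ℕ.< q
    go (suc zero)    zero zero x≢y = ⊥-elim (x≢y refl)
    go (suc (suc q)) _    _    _   = s≤s (s≤s z≤n)

  values : ∀ {n D} (conditions : List (Point q n × Vec ℕ n)) → Poly n D → Fin (length conditions) → 𝔽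
  values conditions P k = let a , is = List.lookup conditions k in hasse a is P

  -- Over a finite field, the pigeonhole principle replaces linear algebra: two polynomials share all
  -- prescribed coefficients, and their difference has all of them zero.
  interpolation : ∀ {n} D (conditions : List (Point q n × Vec ℕ n)) → length conditions ℕ.< dim n D →
    ∃ λ (P : Poly n D) → ¬ IsZero P × (∀ a is → (a , is) ∈ conditions → hasse a is P ≡ 0F)
  interpolation {n} D conditions fewer
    -- There are q^(dim n D) polynomials but only q^(number of conditions) vectors of values.
    with pigeonhole (ℕₚ.^-monoʳ-< q 1<q fewer) (λ c → funToFin (values conditions (fromCoefficients n D (finToFun c))))
  ... | c , d , c<d , same = P ⊖ Q , nonzero , vanishes
    where
    P = fromCoefficients n D (finToFun c)
    Q = fromCoefficients n D (finToFun d)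
    funToFin-cong : ∀ {m} {f g : Fin m → 𝔽} → (∀ k → f k ≡ g k) → funToFin f ≡ funToFin g
    funToFin-cong {zero}  f≡g = refl
    funToFin-cong {suc m} f≡g = cong₂ combine (f≡g zero) (funToFin-cong (f≡g ∘ suc))
    nonzero : ¬ IsZero (P ⊖ Q)
    nonzero z = <⇒≢F c<d (begin
      c                     ≡⟨ funToFin-finToFin {dim n D} c ⟨
      funToFin {dim n D} (finToFun c) ≡⟨ funToFin-cong (fromCoefficients-injective n D (finToFun c) (finToFun d) (⊖-zero P Q z)) ⟩
      funToFin {dim n D} (finToFun d) ≡⟨ funToFin-finToFin {dim n D} d ⟩
      d                     ∎)
      where open ≡-Reasoning
    values≡ : ∀ k → values conditions P k ≡ values conditions Q k
    values≡ k = trans (sym (finToFun-funToFin (values conditions P) k))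
      (trans (cong (λ e → finToFun e k) same) (finToFun-funToFin (values conditions Q) k))
    vanishes : ∀ a is → (a , is) ∈ conditions → hasse a is (P ⊖ Q) ≡ 0F
    vanishes a is a∈ = +-identityˡ-unique _ (hasse a is Q) (trans (hasse-⊖ a is P Q)
      (subst (λ x → hasse (proj₁ x) (proj₂ x) P ≡ hasse (proj₁ x) (proj₂ x) Q) (sym (lookup-index a∈)) (values≡ (index a∈))))

  conditionsAt : ∀ {n} → ℕ → (Point q n → Bool) → Point q n → List (Point q n × Vec ℕ n)
  conditionsAt {n} m K a = if K a then map (a ,_) (indices n m) else []

  length-conditionsAt : ∀ {n} m (K : Point q n → Bool) a → length (conditionsAt m K a) ≡ (if K a then dim n m else 0)
  length-conditionsAt {n} m K a with K a
  ... | true  = trans (length-map (a ,_) (indices n m)) (length-indices n m)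
  ... | false = refl

  ∈-conditionsAt : ∀ {n} m (K : Point q n → Bool) a is → K a ≡ true → Vec.sum is ℕ.< m → (a , is) ∈ conditionsAt m K a
  ∈-conditionsAt m K a is Ka is< rewrite Ka = ∈-map⁺ (a ,_) (∈-indices m is is<)

  vanishing-polynomial : ∀ {n} D m (K : Point q n → Bool) → card K ℕ.* dim n m ℕ.< dim n D →
    ∃ λ (P : Poly n D) → ¬ IsZero P × (∀ a → K a ≡ true → VanishesTo P m a)
  vanishing-polynomial {n} D m K fewer =
    let P , P≢0 , vanishes = interpolation D conditions (subst (ℕ._< dim n D) (sym length≡) fewer) in
    P , P≢0 , λ a Ka is is< → vanishes a is
      (∈-concatMap⁺ (conditionsAt m K) (lose (∈-allPoints a) (∈-conditionsAt m K a is Ka is<)))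
    where
    conditions = concatMap (conditionsAt m K) (allPoints q n)
    length≡ : length conditions ≡ card K ℕ.* dim n m
    length≡ = trans (length-concatMap (conditionsAt m K) (allPoints q n))
      (trans (listSum-cong (length-conditionsAt m K) (allPoints q n))
      (trans (countTrue-* (dim n m) K (allPoints q n)) (ℕₚ.*-comm (dim n m) (card K))))

  -- P and its Hasse derivatives, restricted to a curve, have too many zeros on K.
  vanishes-on-curve : ∀ {n D Λ} m (K : Point q n → Bool) (P : Poly n D) → (∀ a → K a ≡ true → VanishesTo P m a) →
    ∀ (C : Curve≤ q n Λ) ℓ →
    (∀ w → w ℕ.< ℓ → composedLength Λ (D ℕ.∸ w) ℕ.≤ hits F C K ℕ.* (m ℕ.∸ w)) →
    ∀ t → VanishesTo P ℓ (curveAt F C t)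
  vanishes-on-curve {n} {D} {Λ} m K P van C ℓ many t is is< = begin
    hasse (curveAt F C t) is P          ≡⟨ taylorAlong₀ t C is P ⟨
    taylorAlong t C is P 0              ≡⟨ taylor-alongCurve t C is P 0 ⟨
    taylor t 0 (alongCurve C is P)      ≡⟨ taylor-allZero t (alongCurve C is P) allZero ⟩
    0F                                  ∎
    where
    open ≡-Reasoning
    w = Vec.sum is
    taylor-allZero : ∀ t g → All (_≡ 0F) g → taylor t 0 g ≡ 0F
    taylor-allZero t []      []          = refl
    taylor-allZero t (c ∷ g) (c≡0 ∷ g≡0) = 0+0 c≡0 (*-zero t (taylor-allZero t g g≡0))
    -- The restricted derivative has weight w, so order m - w remains at each parameter that the
    -- curve sends into K. Truncated subtraction demands nothing when w exceeds m.
    ν : 𝔽 → ℕ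
    ν s = if K (curveAt F C s) then m ℕ.∸ w else 0
    sum-ν : hits F C K ℕ.* (m ℕ.∸ w) ≡ sumFin ν
    sum-ν = trans (ℕₚ.*-comm (hits F C K) (m ℕ.∸ w))
      (trans (sym (countTrue-* (m ℕ.∸ w) (λ s → K (curveAt F C s)) (allFin q))) (listSum-allFin ν))
    order : ∀ s j → j ℕ.< ν s → taylor s j (alongCurve C is P) ≡ 0F
    order s j j< with K (curveAt F C s) in eq
    ... | true = trans (taylor-alongCurve s C is P j) (taylorAlong-order s C m P (van (curveAt F C s) eq) is j
                   (subst (ℕ._< m) (ℕₚ.+-comm j w) (m<n∸o⇒m+o<n w j<)))
    allZero : All (_≡ 0F) (alongCurve C is P)
    allZero = roots-bound (alongCurve C is P) ν order
      (ℕₚ.≤-trans (length-alongCurve C is P) (subst (composedLength Λ (D ℕ.∸ w) ℕ.≤_) sum-ν (many w is<)))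

  -- Otherwise there are fewer conditions than coefficients, and some nonzero P vanishes to order m
  -- on K, hence to order ℓ on S. The last hypothesis is exactly the negation of `schwartz-zippel`
  -- for ν equal to ℓ on S and 0 elsewhere.
  multiplicity-bound : ∀ {n Λ} D m ℓ (S K : Point q n → Bool) →
    (∀ x → S x ≡ true → ∃ λ (C : Curve≤ q n Λ) → PassesThrough F C x ×
      (∀ w → w ℕ.< ℓ → composedLength Λ (D ℕ.∸ w) ℕ.≤ hits F C K ℕ.* (m ℕ.∸ w))) →
    D ℕ.* q ℕ.^ n ℕ.< q ℕ.* (ℓ ℕ.* card S) ℕ.+ q ℕ.^ n →
    dim n D ℕ.≤ card K ℕ.* dim n m
  multiplicity-bound {n} D m ℓ S K curves large with dim n D ℕ.≤? card K ℕ.* dim n m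
  ... | yes ≤K = ≤K
  ... | no ≰K with vanishing-polynomial D m K (ℕₚ.≰⇒> ≰K)
  ... | P , P≢0 , van = ⊥-elim (ℕₚ.<⇒≱ large (subst (λ s → q ℕ.* s ℕ.+ q ℕ.^ n ℕ.≤ D ℕ.* q ℕ.^ n)
          (countTrue-* ℓ S (allPoints q n)) (schwartz-zippel P P≢0 (λ x → if S x then ℓ else 0) vanS)))
    where
    vanS : ∀ x → VanishesTo P (if S x then ℓ else 0) x
    vanS x with S x in eq
    ... | false = λ is ()
    ... | true with curves x eq
    ... | C , (t , refl) , many = vanishes-on-curve m K P van C ℓ many t

-- Asymptotics

module Asymptotics where
  open import Data.Nat
  open import Data.Nat.Properties
  open ℕ-Solver.+-*-Solver using (solve; _:+_; _:*_; _:=_; con)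

  -- The two absorption identities of binomial coefficients, dim n D = C(D + n − 1, n) for D ≥ 1.
  dim-sucʳ : ∀ n D → D * dim n (suc D) ≡ (D + n) * dim n D
  dim-sucˡ : ∀ n D → suc n * dim (suc n) D ≡ (D + n) * dim n D

  dim-sucˡ n zero    = trans (*-zeroʳ n) (sym (*-zeroʳ n))
  dim-sucˡ n (suc D) = begin
    suc n * (dim n (suc D) + dim (suc n) D)            ≡⟨ *-distribˡ-+ (suc n) (dim n (suc D)) _ ⟩
    suc n * dim n (suc D) + suc n * dim (suc n) D      ≡⟨ cong (suc n * dim n (suc D) +_) (trans (dim-sucˡ n D) (sym (dim-sucʳ n D))) ⟩
    suc n * dim n (suc D) + D * dim n (suc D)          ≡⟨ solve 3 (λ n D x → (con 1 :+ n) :* x :+ D :* x := (con 1 :+ D :+ n) :* x) refl n D (dim n (suc D)) ⟩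
    (suc D + n) * dim n (suc D)                        ∎
    where open ≡-Reasoning

  dim-sucʳ zero    zero    = refl
  dim-sucʳ zero    (suc D) = cong (_* 1) (sym (+-identityʳ (suc D)))
  dim-sucʳ (suc n) D = begin
    D * (dim n (suc D) + dim (suc n) D)                ≡⟨ *-distribˡ-+ D (dim n (suc D)) _ ⟩
    D * dim n (suc D) + D * dim (suc n) D              ≡⟨ cong (_+ D * dim (suc n) D) (trans (dim-sucʳ n D) (sym (dim-sucˡ n D))) ⟩
    suc n * dim (suc n) D + D * dim (suc n) D          ≡⟨ solve 3 (λ n D x → (con 1 :+ n) :* x :+ D :* x := (D :+ (con 1 :+ n)) :* x) refl n D (dim (suc n) D) ⟩
    (D + suc n) * dim (suc n) D                        ∎
    where open ≡-Reasoning

  !-dim-suc : ∀ n D → suc n ! * dim (suc n) D ≡ (D + n) * (n ! * dim n D)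
  !-dim-suc n D = begin
    suc n * n ! * dim (suc n) D     ≡⟨ solve 3 (λ a b c → a :* b :* c := b :* (a :* c)) refl (suc n) (n !) (dim (suc n) D) ⟩
    n ! * (suc n * dim (suc n) D)   ≡⟨ cong (n ! *_) (dim-sucˡ n D) ⟩
    n ! * ((D + n) * dim n D)       ≡⟨ solve 3 (λ a b c → a :* (b :* c) := b :* (a :* c)) refl (n !) (D + n) (dim n D) ⟩
    (D + n) * (n ! * dim n D)       ∎
    where open ≡-Reasoning

  -- For D ≥ 1, n! · `dim n D` is the rising factorial D(D + 1)⋯(D + n - 1), whose factors lie
  -- between D and D + n. At D = 0 the case n = 0 would fail, as 0^0 = 1 while `dim 0 0` is 0.
  dim-lower : ∀ n D → 1 ≤ D → D ^ n ≤ n ! * dim n D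
  dim-lower zero    (suc D) _  = ≤-refl
  dim-lower (suc n) D      1≤D = subst (D * D ^ n ≤_) (sym (!-dim-suc n D)) (*-mono-≤ (m≤m+n D n) (dim-lower n D 1≤D))

  dim-upper : ∀ n D → n ! * dim n D ≤ (D + n) ^ n
  dim-upper zero    zero    = z≤n
  dim-upper zero    (suc D) = ≤-refl
  dim-upper (suc n) D       = subst (_≤ (D + suc n) ^ suc n) (sym (!-dim-suc n D))
    (*-mono-≤ D+n≤ (≤-trans (dim-upper n D) (^-monoˡ-≤ n D+n≤)))
    where D+n≤ = +-monoʳ-≤ D (n≤1+n n)

  -- (M k + b)^n = M^n k^n + O(k^(n−1)), multiplied by k.
  power-asymptotics : ∀ M b n → ∃ λ c → ∀ k → 1 ≤ k → k * (M * k + b) ^ n ≤ (M ^ n * k + c) * k ^ n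
  power-asymptotics M b zero = 0 , λ k _ → ≤-reflexive (solve 1 (λ k → k :* con 1 := (con 1 :* k :+ con 0) :* con 1) refl k)
  power-asymptotics M b (suc n) with power-asymptotics M b n
  -- With N = M^n, the product (Mk + b)(Nk + c) is MNk² + (cM + bN)k + bc, and k ≥ 1 lets bc be
  -- absorbed into the linear term.
  ... | c , bound = c * M + b * M ^ n + b * c , bound'
    where
    open ≤-Reasoning
    bound' : ∀ k → 1 ≤ k → k * ((M * k + b) * (M * k + b) ^ n) ≤ (M * M ^ n * k + (c * M + b * M ^ n + b * c)) * (k * k ^ n)
    bound' k 1≤k = begin
      k * (x * x ^ n)
        ≡⟨ solve 3 (λ k x y → k :* (x :* y) := x :* (k :* y)) refl k x (x ^ n) ⟩
      x * (k * x ^ n)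
        ≤⟨ *-monoʳ-≤ x (bound k 1≤k) ⟩
      x * ((M ^ n * k + c) * k ^ n)
        ≡⟨ solve 6 (λ M k b N c p → (M :* k :+ b) :* ((N :* k :+ c) :* p) := (k :* (M :* N :* k :+ (c :* M :+ b :* N)) :+ con 1 :* (b :* c)) :* p) refl M k b (M ^ n) c (k ^ n) ⟩
      (k * (M * M ^ n * k + (c * M + b * M ^ n)) + 1 * (b * c)) * k ^ n
        ≤⟨ *-monoˡ-≤ (k ^ n) (+-monoʳ-≤ (k * (M * M ^ n * k + (c * M + b * M ^ n))) (*-monoˡ-≤ (b * c) 1≤k)) ⟩
      (k * (M * M ^ n * k + (c * M + b * M ^ n)) + k * (b * c)) * k ^ n
        ≡⟨ solve 6 (λ M k b N c p → (k :* (M :* N :* k :+ (c :* M :+ b :* N)) :+ k :* (b :* c)) :* p := (M :* N :* k :+ (c :* M :+ b :* N :+ b :* c)) :* (k :* p)) refl M k b (M ^ n) c (k ^ n) ⟩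
      (M * M ^ n * k + (c * M + b * M ^ n + b * c)) * (k * k ^ n) ∎
      where x = M * k + b

  -- The estimates of `dim` give E^n k ≤ κ M^n k + κc for every k ≥ 1. If E^n exceeded κ M^n, this
  -- would force k ≤ κc, which fails at k = κc + 1; so a single k replaces the limit.
  dim-ratio : ∀ n κ E M → 1 ≤ E → (∀ k → 1 ≤ k → dim n (E * k) ≤ κ * dim n (M * k)) → E ^ n ≤ κ * M ^ n
  dim-ratio n κ E M 1≤E dims with E ^ n ≤? κ * M ^ n | power-asymptotics M n n
  ... | yes E≤ | _         = E≤
  ... | no  E≰ | c , bound = ⊥-elim (n≮n (κ * c) (+-cancelˡ-≤ (κ * M ^ n * k) _ _ (begin
      κ * M ^ n * k + k                ≡⟨ +-comm (κ * M ^ n * k) k ⟩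
      suc (κ * M ^ n) * k              ≤⟨ *-monoˡ-≤ k (≰⇒> E≰) ⟩
      E ^ n * k                        ≤⟨ *-cancelʳ-≤ _ _ (k ^ n) {{m^n≢0 k n}} scaled ⟩
      κ * M ^ n * k + κ * c            ∎)))
    where
    open ≤-Reasoning
    k = suc (κ * c)
    ^-distribʳ-* : ∀ n a b → (a * b) ^ n ≡ a ^ n * b ^ n
    ^-distribʳ-* zero    a b = refl
    ^-distribʳ-* (suc n) a b = trans (cong (a * b *_) (^-distribʳ-* n a b))
      (solve 4 (λ a b c d → a :* b :* (c :* d) := a :* c :* (b :* d)) refl a b (a ^ n) (b ^ n))
    scaled : E ^ n * k * k ^ n ≤ (κ * M ^ n * k + κ * c) * k ^ n
    scaled = begin
      E ^ n * k * k ^ n                  ≡⟨ solve 3 (λ a b c → a :* b :* c := b :* (a :* c)) refl (E ^ n) k (k ^ n) ⟩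
      k * (E ^ n * k ^ n)                ≡⟨ cong (k *_) (^-distribʳ-* n E k) ⟨
      k * (E * k) ^ n                    ≤⟨ *-monoʳ-≤ k (dim-lower n (E * k) (*-mono-≤ 1≤E (s≤s z≤n))) ⟩
      k * (n ! * dim n (E * k))          ≤⟨ *-monoʳ-≤ k (*-monoʳ-≤ (n !) (dims k (s≤s z≤n))) ⟩
      k * (n ! * (κ * dim n (M * k)))    ≡⟨ solve 4 (λ k f κ d → k :* (f :* (κ :* d)) := κ :* (k :* (f :* d))) refl k (n !) κ (dim n (M * k)) ⟩
      κ * (k * (n ! * dim n (M * k)))    ≤⟨ *-monoʳ-≤ κ (*-monoʳ-≤ k (dim-upper n (M * k))) ⟩
      κ * (k * (M * k + n) ^ n)          ≤⟨ *-monoʳ-≤ κ (bound k (s≤s z≤n)) ⟩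
      κ * ((M ^ n * k + c) * k ^ n)      ≡⟨ solve 5 (λ κ N k c p → κ :* ((N :* k :+ c) :* p) := (κ :* N :* k :+ κ :* c) :* p) refl κ (M ^ n) k c (k ^ n) ⟩
      (κ * M ^ n * k + κ * c) * k ^ n    ∎

  -- The bound in natural numbers

  module _ {q : ℕ} (F : FiniteField q) where
    open Vanishing F using (multiplicity-bound; 1<q)
    open Multivariate F using (composedLength)

    -- The slack of Λ - 1 is independent of k and costs nothing asymptotically.
    composedLength≤ : ∀ Λ e → 1 ≤ Λ → composedLength Λ e ≤ Λ * e
    composedLength≤ Λ zero    1≤Λ = z≤n
    composedLength≤ Λ (suc e) 1≤Λ = subst (suc (Λ * e) ≤_) (sym (*-suc Λ e)) (+-monoˡ-≤ (Λ * e) 1≤Λ)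

    -- With s = |S|, Q = q^n, r = s − Q and ηq = α/β, the multiplicities ℓ = Qαk on S and m = (Qα + βΛr)k on K
    -- and the degree bound D = sαk satisfy the constraints of multiplicity-bound for every k; then k → ∞.
    curves-bound : ∀ n Λ α β r (S K : Point q (suc n) → Bool) → 1 ≤ Λ → .{{NonZero β}} → Λ * β < α →
      card S ≡ q ^ n + r →
      (∀ x → S x ≡ true → ∃ λ (C : Curve≤ q (suc n) Λ) → PassesThrough F C x × α ≤ hits F C K * β) →
      (card S * α) ^ suc n ≤ card K * (q ^ n * α + β * Λ * r) ^ suc n
    curves-bound n Λ α β r S K 1≤Λ Λβ<α s≡ curves =
      dim-ratio (suc n) (card K) (card S * α) (Q * α + β * Λ * r) (*-mono-≤ 1≤s 1≤α) dims
      where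
      open ≤-Reasoning
      Q = q ^ n
      instance q≢0 : NonZero q
               q≢0 = >-nonZero (<-trans (s≤s z≤n) 1<q)
      1≤α : 1 ≤ α
      1≤α = ≤-trans (s≤s z≤n) Λβ<α
      1≤s : 1 ≤ card S
      1≤s = subst (1 ≤_) (sym s≡) (≤-trans (m^n>0 q n) (m≤m+n Q r))
      dims : ∀ k → 1 ≤ k → dim (suc n) (card S * α * k) ≤ card K * dim (suc n) ((Q * α + β * Λ * r) * k)
      dims k 1≤k = multiplicity-bound D m ℓ S K (λ x Sx → let C , through , many = curves x Sx in C , through , enough (hits F C K) many) large
        where
        D = card S * α * k
        m = (Q * α + β * Λ * r) * k
        ℓ = Q * α * k
        -- The choice ℓ = Qαk makes D q^(n+1) equal to q ℓ |S|; strictness comes from the extra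
        -- q^(n+1) alone.
        large : D * (q * Q) < q * (ℓ * card S) + q * Q
        large = begin-strict
          D * (q * Q)                  ≡⟨ solve 5 (λ s α k q Q → s :* α :* k :* (q :* Q) := q :* (Q :* α :* k :* s)) refl (card S) α k q Q ⟩
          q * (ℓ * card S)             <⟨ m<m+n (q * (ℓ * card S)) (m^n>0 q (suc n)) ⟩
          q * (ℓ * card S) + q * Q     ∎
        D≡ : D ≡ ℓ + r * α * k
        D≡ = trans (cong (λ s → s * α * k) s≡) (solve 4 (λ Q r α k → (Q :+ r) :* α :* k := Q :* α :* k :+ r :* α :* k) refl Q r α k)
        m≡ : m ≡ ℓ + β * Λ * r * k
        m≡ = *-distribʳ-+ k (Q * α) (β * Λ * r)
        -- With v = ℓ - w, D - w = v + rαk and m - w = v + βΛrk. After multiplication by β the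
        -- r-terms of Λ(D - w) and (α/β)(m - w) agree exactly, which is how m was chosen; the
        -- v-terms compare by Λβ < α.
        enough : ∀ h → α ≤ h * β → ∀ w → w < ℓ → composedLength Λ (D ∸ w) ≤ h * (m ∸ w)
        enough h α≤hβ w w<ℓ = ≤-trans (composedLength≤ Λ (D ∸ w) 1≤Λ) (*-cancelˡ-≤ β (begin
          β * (Λ * (D ∸ w))                  ≡⟨ cong (λ x → β * (Λ * x)) (trans (cong (_∸ w) D≡) (+-∸-comm (r * α * k) (<⇒≤ w<ℓ))) ⟩
          β * (Λ * (v + r * α * k))          ≡⟨ solve 6 (λ β Λ v r α k → β :* (Λ :* (v :+ r :* α :* k)) := Λ :* β :* v :+ α :* (β :* Λ :* r :* k)) refl β Λ v r α k ⟩
          Λ * β * v + α * (β * Λ * r * k)    ≤⟨ +-monoˡ-≤ _ (*-monoˡ-≤ v (<⇒≤ Λβ<α)) ⟩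
          α * v + α * (β * Λ * r * k)        ≡⟨ *-distribˡ-+ α v _ ⟨
          α * (v + β * Λ * r * k)            ≡⟨ cong (α *_) (trans (cong (_∸ w) m≡) (+-∸-comm (β * Λ * r * k) (<⇒≤ w<ℓ))) ⟨
          α * (m ∸ w)                        ≤⟨ *-monoˡ-≤ (m ∸ w) α≤hβ ⟩
          h * β * (m ∸ w)                    ≡⟨ solve 3 (λ h β x → h :* β :* x := β :* (h :* x)) refl h β (m ∸ w) ⟩
          β * (h * (m ∸ w))                  ∎))
          where v = ℓ ∸ w

-- Rational arithmetic

open import Data.Integer as ℤ using (+_; -[1+_])
import Data.Integer.Properties as ℤₚ
open import Data.Rational using (ℚ; 0ℚ; 1ℚ; _*_; _+_; _-_; -_; _≤_; _<_; _≟_; mkℚ; toℚᵘ; positive; nonNegative; 1/_; ≢-nonZero)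
import Data.Rational as ℚ
open import Data.Rational.Properties
open import Data.Rational.Solver using (module +-*-Solver)
open import Data.Rational.Unnormalised as ℚᵘ using (mkℚᵘ; *≡*; *≤*; *<*)
import Data.Rational.Unnormalised.Properties as ℚᵘₚ
open +-*-Solver using (solve; _:+_; _:*_; _:-_; _:=_; con)
open Asymptotics using (curves-bound)

-- `ℕtoℚ` normalises through a gcd and does not compute on variables, so its arithmetic is proved on
-- unnormalised fractions and transported.
toℚᵘ-ℕtoℚ : ∀ n → toℚᵘ (ℕtoℚ n) ℚᵘ.≃ mkℚᵘ (+ n) 0
toℚᵘ-ℕtoℚ n = toℚᵘ-fromℚᵘ (mkℚᵘ (+ n) 0)

ℕtoℚ-+ : ∀ m n → ℕtoℚ (m ℕ.+ n) ≡ ℕtoℚ m + ℕtoℚ n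
ℕtoℚ-+ m n = toℚᵘ-injective (begin
  toℚᵘ (ℕtoℚ (m ℕ.+ n))                   ≈⟨ toℚᵘ-ℕtoℚ (m ℕ.+ n) ⟩
  mkℚᵘ (+ (m ℕ.+ n)) 0                    ≈⟨ *≡* (cong (ℤ._* (+ 1)) (sym (cong₂ ℤ._+_ (ℤₚ.*-identityʳ (+ m)) (ℤₚ.*-identityʳ (+ n))))) ⟩
  mkℚᵘ (+ m) 0 ℚᵘ.+ mkℚᵘ (+ n) 0          ≈⟨ ℚᵘₚ.+-cong (toℚᵘ-ℕtoℚ m) (toℚᵘ-ℕtoℚ n) ⟨
  toℚᵘ (ℕtoℚ m) ℚᵘ.+ toℚᵘ (ℕtoℚ n)        ≈⟨ toℚᵘ-homo-+ (ℕtoℚ m) (ℕtoℚ n) ⟨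
  toℚᵘ (ℕtoℚ m + ℕtoℚ n)                  ∎)
  where open ℚᵘₚ.≃-Reasoning

ℕtoℚ-* : ∀ m n → ℕtoℚ (m ℕ.* n) ≡ ℕtoℚ m * ℕtoℚ n
ℕtoℚ-* m n = toℚᵘ-injective (begin
  toℚᵘ (ℕtoℚ (m ℕ.* n))                   ≈⟨ toℚᵘ-ℕtoℚ (m ℕ.* n) ⟩
  mkℚᵘ (+ (m ℕ.* n)) 0                    ≈⟨ *≡* (cong (ℤ._* (+ 1)) (ℤₚ.pos-* m n)) ⟩
  mkℚᵘ (+ m) 0 ℚᵘ.* mkℚᵘ (+ n) 0          ≈⟨ ℚᵘₚ.*-cong (toℚᵘ-ℕtoℚ m) (toℚᵘ-ℕtoℚ n) ⟨
  toℚᵘ (ℕtoℚ m) ℚᵘ.* toℚᵘ (ℕtoℚ n)        ≈⟨ toℚᵘ-homo-* (ℕtoℚ m) (ℕtoℚ n) ⟨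
  toℚᵘ (ℕtoℚ m * ℕtoℚ n)                  ∎)
  where open ℚᵘₚ.≃-Reasoning

ℕtoℚ-mono-≤ : ∀ {m n} → m ℕ.≤ n → ℕtoℚ m ≤ ℕtoℚ n
ℕtoℚ-mono-≤ {m} {n} m≤n = toℚᵘ-cancel-≤ (begin
  toℚᵘ (ℕtoℚ m)   ≃⟨ toℚᵘ-ℕtoℚ m ⟩
  mkℚᵘ (+ m) 0    ≤⟨ *≤* (ℤₚ.*-monoʳ-≤-nonNeg (+ 1) (ℤ.+≤+ m≤n)) ⟩
  mkℚᵘ (+ n) 0    ≃⟨ toℚᵘ-ℕtoℚ n ⟨
  toℚᵘ (ℕtoℚ n)   ∎)
  where open ℚᵘₚ.≤-Reasoning

ℕtoℚ-mono-< : ∀ {m n} → m ℕ.< n → ℕtoℚ m < ℕtoℚ n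
ℕtoℚ-mono-< {m} {n} m<n = toℚᵘ-cancel-< (begin-strict
  toℚᵘ (ℕtoℚ m)   ≃⟨ toℚᵘ-ℕtoℚ m ⟩
  mkℚᵘ (+ m) 0    <⟨ *<* (ℤₚ.*-monoʳ-<-pos (+ 1) (ℤ.+<+ m<n)) ⟩
  mkℚᵘ (+ n) 0    ≃⟨ toℚᵘ-ℕtoℚ n ⟨
  toℚᵘ (ℕtoℚ n)   ∎)
  where open ℚᵘₚ.≤-Reasoning

ℕtoℚ-cancel-≤ : ∀ {m n} → ℕtoℚ m ≤ ℕtoℚ n → m ℕ.≤ n
ℕtoℚ-cancel-≤ {m} {n} m≤n with m ℕ.≤? n
... | yes p = p
... | no m≰n = ⊥-elim (<-irrefl refl (<-≤-trans (ℕtoℚ-mono-< (ℕₚ.≰⇒> m≰n)) m≤n))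

ℕtoℚ-cancel-< : ∀ {m n} → ℕtoℚ m < ℕtoℚ n → m ℕ.< n
ℕtoℚ-cancel-< {m} {n} m<n with m ℕ.<? n
... | yes p = p
... | no m≮n = ⊥-elim (<-irrefl refl (<-≤-trans m<n (ℕtoℚ-mono-≤ (ℕₚ.≮⇒≥ m≮n))))

ℕtoℚ-^ : ∀ m n → ℕtoℚ (m ℕ.^ n) ≡ ℕtoℚ m ^ℚ n
ℕtoℚ-^ m zero    = refl
ℕtoℚ-^ m (suc n) = trans (ℕtoℚ-* m (m ℕ.^ n)) (cong (ℕtoℚ m *_) (ℕtoℚ-^ m n))

^ℚ-distrib-* : ∀ p r n → (p * r) ^ℚ n ≡ p ^ℚ n * r ^ℚ n
^ℚ-distrib-* p r zero    = refl
^ℚ-distrib-* p r (suc n) = trans (cong (p * r *_) (^ℚ-distrib-* p r n))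
  (solve 4 (λ a b c d → a :* b :* (c :* d) := a :* c :* (b :* d)) refl p r (p ^ℚ n) (r ^ℚ n))

^ℚ-nonNeg : ∀ {p} n → 0ℚ ≤ p → 0ℚ ≤ p ^ℚ n
^ℚ-nonNeg zero    0≤p = ℕtoℚ-mono-≤ {0} {1} ℕ.z≤n
^ℚ-nonNeg {p} (suc n) 0≤p = nonNegative⁻¹ (p * p ^ℚ n)
  {{nonNeg*nonNeg⇒nonNeg p {{nonNegative 0≤p}} (p ^ℚ n) {{nonNegative (^ℚ-nonNeg n 0≤p)}}}}

^ℚ-mono-≤ : ∀ {p r} n → 0ℚ ≤ p → p ≤ r → p ^ℚ n ≤ r ^ℚ n
^ℚ-mono-≤ zero    0≤p p≤r = ≤-refl
^ℚ-mono-≤ {p} {r} (suc n) 0≤p p≤r = ≤-trans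
  (*-monoʳ-≤-nonNeg (p ^ℚ n) {{nonNegative (^ℚ-nonNeg n 0≤p)}} p≤r)
  (*-monoˡ-≤-nonNeg r {{nonNegative (≤-trans 0≤p p≤r)}} (^ℚ-mono-≤ n 0≤p p≤r))

1^ℚ : ∀ n → 1ℚ ^ℚ n ≡ 1ℚ
1^ℚ zero    = refl
1^ℚ (suc n) = trans (*-identityˡ _) (1^ℚ n)

÷'-* : ∀ p {d} → 0ℚ < d → (p ÷' d) * d ≡ p
÷'-* p {d} 0<d with d ≟ 0ℚ
... | yes d≡0 = ⊥-elim (<⇒≢ 0<d (sym d≡0))
... | no d≢0 = trans (*-assoc p (1/_ d {{≢-nonZero d≢0}}) d) (trans (cong (p *_) (*-inverseˡ d {{≢-nonZero d≢0}})) (*-identityʳ p))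

positive-fraction : ∀ a → 0ℚ < a → ∃₂ λ α β → a * ℕtoℚ (suc β) ≡ ℕtoℚ α
positive-fraction (mkℚ -[1+ _ ] _ _) (ℚ.*<* ())
positive-fraction a@(mkℚ (+ α) β _) _ = α , β , toℚᵘ-injective (begin
  toℚᵘ (a * ℕtoℚ (suc β))                 ≈⟨ toℚᵘ-homo-* a (ℕtoℚ (suc β)) ⟩
  mkℚᵘ (+ α) β ℚᵘ.* toℚᵘ (ℕtoℚ (suc β))   ≈⟨ ℚᵘₚ.*-cong (ℚᵘₚ.≃-refl {mkℚᵘ (+ α) β}) (toℚᵘ-ℕtoℚ (suc β)) ⟩
  mkℚᵘ (+ α) β ℚᵘ.* mkℚᵘ (+ suc β) 0      ≈⟨ *≡* (trans (ℤₚ.*-identityʳ (+ α ℤ.* + suc β)) (cong (λ b → + α ℤ.* + b) (sym (ℕₚ.*-identityʳ (suc β))))) ⟩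
  mkℚᵘ (+ α) 0                            ≈⟨ toℚᵘ-ℕtoℚ α ⟨
  toℚᵘ (ℕtoℚ α)                           ∎)
  where open ℚᵘₚ.≃-Reasoning

countTrue-witness : ∀ {A : Set} (P : A → Bool) xs → 1 ℕ.≤ countTrue P xs → ∃ λ x → P x ≡ true
countTrue-witness P (x ∷ xs) 1≤ with P x in eq
... | true  = x , eq
... | false = countTrue-witness P xs 1≤

countTrue-positive : ∀ {A : Set} (P : A → Bool) {x} xs → x ∈ xs → P x ≡ true → 1 ℕ.≤ countTrue P xs
countTrue-positive P (x ∷ xs) (here refl) Px rewrite Px = ℕ.s≤s ℕ.z≤n
countTrue-positive P (y ∷ xs) (there x∈)  Px = ℕₚ.≤-trans (countTrue-positive P xs x∈ Px) (ℕₚ.m≤n+m _ _)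

p≤q⇒0≤q-p : ∀ {p q} → p ≤ q → 0ℚ ≤ q - p
p≤q⇒0≤q-p {p} {q} p≤q = subst (_≤ q - p) (+-inverseʳ p) (+-monoˡ-≤ (- p) p≤q)

p<q⇒0<q-p : ∀ {p q} → p < q → 0ℚ < q - p
p<q⇒0<q-p {p} {q} p<q = subst (_< q - p) (+-inverseʳ p) (+-monoˡ-< (- p) p<q)

p≤p+nonNeg : ∀ p {d} → 0ℚ ≤ d → p ≤ p + d
p≤p+nonNeg p {d} 0≤d = subst (_≤ p + d) (+-identityʳ p) (+-monoʳ-≤ p 0≤d)

0≤* : ∀ {p r} → 0ℚ ≤ p → 0ℚ ≤ r → 0ℚ ≤ p * r
0≤* {p} {r} 0≤p 0≤r = nonNegative⁻¹ (p * r) {{nonNeg*nonNeg⇒nonNeg p {{nonNegative 0≤p}} r {{nonNegative 0≤r}}}}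

0<* : ∀ {p r} → 0ℚ < p → 0ℚ < r → 0ℚ < p * r
0<* {p} {r} 0<p 0<r = positive⁻¹ (p * r) {{pos*pos⇒pos p {{positive 0<p}} r {{positive 0<r}}}}

cancel-≤ : ∀ {p r} d → 0ℚ < d → p * d ≤ r * d → p ≤ r
cancel-≤ d 0<d = *-cancelʳ-≤-pos d {{positive 0<d}}

cancel-< : ∀ {p r} d → 0ℚ ≤ d → p * d < r * d → p < r
cancel-< d 0≤d = *-cancelʳ-<-nonNeg d {{nonNegative 0≤d}}

-- x and a stand for λq and ηq.
module Bounds (x a Λ : ℚ) (0<x : 0ℚ < x) (0≤Λ : 0ℚ ≤ Λ) (Λ<a : Λ < a) where

  0<a : 0ℚ < a
  0<a = ≤-<-trans 0≤Λ Λ<a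

  slope : ℚ
  slope = (x - 1ℚ) ÷' a

  den : ℚ
  den = Λ * slope + 1ℚ

  bound : ℚ
  bound = x ÷' den

  slope-* : slope * a ≡ x - 1ℚ
  slope-* = ÷'-* (x - 1ℚ) 0<a

  den-* : den * a ≡ Λ * (x - 1ℚ) + a
  den-* = trans (solve 3 (λ Λ s a → (Λ :* s :+ con 1ℚ) :* a := Λ :* (s :* a) :+ a) refl Λ slope a) (cong (λ y → Λ * y + a) slope-*)

  -- x may be below 1 and the slope negative, but den · a = (a - Λ) + Λx, which is positive because
  -- Λ < a.
  0<den : 0ℚ < den
  0<den = cancel-< a (<⇒≤ 0<a) (subst₂ _<_ (sym (*-zeroˡ a))
    (trans (solve 3 (λ Λ x a → (a :- Λ) :+ Λ :* x := Λ :* (x :- con 1ℚ) :+ a) refl Λ x a) (sym den-*))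
    (<-≤-trans (p<q⇒0<q-p Λ<a) (p≤p+nonNeg (a - Λ) (0≤* 0≤Λ (<⇒≤ 0<x)))))

  bound-* : bound * den ≡ x
  bound-* = ÷'-* x 0<den

  0≤bound : 0ℚ ≤ bound
  0≤bound = cancel-≤ den 0<den (subst₂ _≤_ (sym (*-zeroˡ den)) (sym bound-*) (<⇒≤ 0<x))

  -- It suffices that x ≤ den, and den · a - x · a = (a - Λ)(1 - x).
  bound≤1 : x ≤ 1ℚ → bound ≤ 1ℚ
  bound≤1 x≤1 = cancel-≤ den 0<den (subst₂ _≤_ (sym bound-*) (sym (*-identityˡ den))
    (cancel-≤ a 0<a (subst (x * a ≤_)
      (trans (solve 3 (λ x a Λ → x :* a :+ (a :- Λ) :* (con 1ℚ :- x) := Λ :* (x :- con 1ℚ) :+ a) refl x a Λ) (sym den-*))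
      (p≤p+nonNeg (x * a) (0≤* (p≤q⇒0≤q-p (<⇒≤ Λ<a)) (p≤q⇒0≤q-p x≤1))))))

  0<Λ+1 : 0ℚ < Λ + 1ℚ
  0<Λ+1 = +-mono-≤-< 0≤Λ (ℕtoℚ-mono-< {0} {1} (ℕ.s≤s ℕ.z≤n))

  simple : ℚ
  simple = a ÷' (Λ + 1ℚ)

  simple-* : simple * (Λ + 1ℚ) ≡ a
  simple-* = ÷'-* a 0<Λ+1

  0≤simple : 0ℚ ≤ simple
  0≤simple = cancel-≤ (Λ + 1ℚ) 0<Λ+1 (subst₂ _≤_ (sym (*-zeroˡ (Λ + 1ℚ))) (sym simple-*) (<⇒≤ 0<a))

  -- After clearing both denominators, the difference of the two sides is a(x - a + Λ).
  simple≤bound : a ≤ x → simple ≤ bound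
  simple≤bound a≤x = cancel-≤ den 0<den (subst (simple * den ≤_) (sym bound-*)
    (cancel-≤ (a * (Λ + 1ℚ)) (0<* 0<a 0<Λ+1) (subst₂ _≤_ lhs rhs
      (p≤p+nonNeg (a * (Λ * (x - 1ℚ) + a)) (0≤* (<⇒≤ 0<a) (≤-trans (p≤q⇒0≤q-p a≤x) (p≤p+nonNeg (x - a) 0≤Λ)))))))
    where
    lhs : a * (Λ * (x - 1ℚ) + a) ≡ simple * den * (a * (Λ + 1ℚ))
    lhs = begin
      a * (Λ * (x - 1ℚ) + a)                    ≡⟨ cong₂ _*_ simple-* den-* ⟨
      simple * (Λ + 1ℚ) * (den * a)             ≡⟨ solve 4 (λ y l d a → y :* l :* (d :* a) := y :* d :* (a :* l)) refl simple (Λ + 1ℚ) den a ⟩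
      simple * den * (a * (Λ + 1ℚ))             ∎
      where open ≡-Reasoning
    rhs : a * (Λ * (x - 1ℚ) + a) + a * (x - a + Λ) ≡ x * (a * (Λ + 1ℚ))
    rhs = solve 3 (λ a Λ x → a :* (Λ :* (x :- con 1ℚ) :+ a) :+ a :* (x :- a :+ Λ) := x :* (a :* (Λ :+ con 1ℚ))) refl a Λ x

  -- For x = (Q + r)/Q and a = α/β, den is (Qα + βΛr)/(Qα). So the rational bound is the quotient
  -- E/M to which `dim-ratio` is applied.
  bound-fraction : ∀ Q α β r → x * Q ≡ Q + r → a * β ≡ α → bound * (Q * α + β * Λ * r) ≡ (Q + r) * α
  bound-fraction Q α β r xQ≡ aβ≡ = begin
    bound * (Q * α + β * Λ * r)       ≡⟨ cong (bound *_) den-fraction ⟨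
    bound * (den * (Q * α))           ≡⟨ *-assoc bound den (Q * α) ⟨
    bound * den * (Q * α)             ≡⟨ cong (_* (Q * α)) bound-* ⟩
    x * (Q * α)                       ≡⟨ *-assoc x Q α ⟨
    x * Q * α                         ≡⟨ cong (_* α) xQ≡ ⟩
    (Q + r) * α                       ∎
    where
    open ≡-Reasoning
    den-fraction : den * (Q * α) ≡ Q * α + β * Λ * r
    den-fraction = begin
      den * (Q * α)                                  ≡⟨ cong (λ y → den * (Q * y)) aβ≡ ⟨
      den * (Q * (a * β))                            ≡⟨ solve 4 (λ d Q a β → d :* (Q :* (a :* β)) := d :* a :* (Q :* β)) refl den Q a β ⟩
      den * a * (Q * β)                              ≡⟨ cong (_* (Q * β)) den-* ⟩
      (Λ * (x - 1ℚ) + a) * (Q * β)                   ≡⟨ solve 5 (λ Λ x a Q β → (Λ :* (x :- con 1ℚ) :+ a) :* (Q :* β) := Q :* (a :* β) :+ β :* Λ :* (x :* Q :- Q)) refl Λ x a Q β ⟩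
      Q * (a * β) + β * Λ * (x * Q - Q)              ≡⟨ cong₂ (λ y z → Q * y + β * Λ * (z - Q)) aβ≡ xQ≡ ⟩
      Q * α + β * Λ * (Q + r - Q)                    ≡⟨ solve 5 (λ Q α β Λ r → Q :* α :+ β :* Λ :* (Q :+ r :- Q) := Q :* α :+ β :* Λ :* r) refl Q α β Λ r ⟩
      Q * α + β * Λ * r                              ∎

power-bound : ∀ n κ E M b → 0 ℕ.< M → b * ℕtoℚ M ≡ ℕtoℚ E → E ℕ.^ n ℕ.≤ κ ℕ.* M ℕ.^ n → b ^ℚ n ≤ ℕtoℚ κ
power-bound n κ E M b 0<M bM≡E E≤ = cancel-≤ (ℕtoℚ (M ℕ.^ n)) (ℕtoℚ-mono-< {0} {M ℕ.^ n} (ℕₚ.m^n>0 M {{ℕ.>-nonZero 0<M}} n)) (begin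
  b ^ℚ n * ℕtoℚ (M ℕ.^ n)     ≡⟨ cong (b ^ℚ n *_) (ℕtoℚ-^ M n) ⟩
  b ^ℚ n * ℕtoℚ M ^ℚ n        ≡⟨ ^ℚ-distrib-* b (ℕtoℚ M) n ⟨
  (b * ℕtoℚ M) ^ℚ n           ≡⟨ cong (_^ℚ n) bM≡E ⟩
  ℕtoℚ E ^ℚ n                 ≡⟨ ℕtoℚ-^ E n ⟨
  ℕtoℚ (E ℕ.^ n)              ≤⟨ ℕtoℚ-mono-≤ {E ℕ.^ n} {κ ℕ.* M ℕ.^ n} E≤ ⟩
  ℕtoℚ (κ ℕ.* M ℕ.^ n)        ≡⟨ ℕtoℚ-* κ (M ℕ.^ n) ⟩
  ℕtoℚ κ * ℕtoℚ (M ℕ.^ n)     ∎)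
  where open ≤-Reasoning

theorem13 : (q : ℕ) (F : FiniteField q) (n : ℕ) → 1 ℕ.≤ n →
    (lam η : ℚ) → 0ℚ < lam → 0ℚ < η →
    (Λ : ℕ) → 0 ℕ.< Λ → ℕtoℚ Λ < η * ℕtoℚ q →
    (S K : Point q n → Bool) →
    ℕtoℚ (card S) ≡ lam * (ℕtoℚ q ^ℚ n) →
    (∀ x → S x ≡ true →
    ∃ λ (C : Curve≤ q n Λ) → PassesThrough F C x × η * ℕtoℚ q ≤ ℕtoℚ (hits F C K)) →
    ((lam * ℕtoℚ q) ÷' (ℕtoℚ Λ * ((lam * ℕtoℚ q - 1ℚ) ÷' (η * ℕtoℚ q)) + 1ℚ)) ^ℚ n
    ≤ ℕtoℚ (card K)
    × (η ≤ lam → ((η * ℕtoℚ q) ÷' (ℕtoℚ Λ + 1ℚ)) ^ℚ n ≤ ℕtoℚ (card K))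
theorem13 q F (suc n) _ lam η 0<lam 0<η Λ 0<Λ Λ<ηq S K cardS curves =
  bound^n≤K , λ η≤lam → ≤-trans
    (^ℚ-mono-≤ (suc n) B.0≤simple (B.simple≤bound (*-monoʳ-≤-nonNeg (ℕtoℚ q) {{nonNegative (<⇒≤ 0<q)}} η≤lam)))
    bound^n≤K
  where
  0<q : 0ℚ < ℕtoℚ q
  0<q = ℕtoℚ-mono-< {0} {q} (ℕₚ.<-trans (ℕ.s≤s ℕ.z≤n) (Vanishing.1<q F))

  module B = Bounds (lam * ℕtoℚ q) (η * ℕtoℚ q) (ℕtoℚ Λ) (0<* 0<lam 0<q) (ℕtoℚ-mono-≤ {0} {Λ} ℕ.z≤n) Λ<ηq

  -- The ambient dimension is `suc n`, so λq = |S|/Q, and the cases λq ≥ 1 and λq ≤ 1 become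
  -- comparisons of |S| with Q.
  Q = q ℕ.^ n

  0<Q : 0 ℕ.< Q
  0<Q = ℕₚ.m^n>0 q {{ℕ.>-nonZero (ℕₚ.<-trans (ℕ.s≤s ℕ.z≤n) (Vanishing.1<q F))}} n

  lamqQ≡s : lam * ℕtoℚ q * ℕtoℚ Q ≡ ℕtoℚ (card S)
  lamqQ≡s = trans (*-assoc lam (ℕtoℚ q) (ℕtoℚ Q)) (trans (cong (λ y → lam * (ℕtoℚ q * y)) (ℕtoℚ-^ q n)) (sym cardS))

  -- S is nonempty because λ > 0, and the curve through any of its points meets K because ηq > 0.
  -- This settles the case where the bound is at most 1.
  1≤K : 1 ℕ.≤ card K
  1≤K =
    let x , Sx       = countTrue-witness S (allPoints q (suc n)) (ℕtoℚ-cancel-< {0} {card S}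
                         (subst (0ℚ <_) lamqQ≡s (0<* (0<* 0<lam 0<q) (ℕtoℚ-mono-< {0} {Q} 0<Q))))
        C , _ , many = curves x Sx
        t , Kt       = countTrue-witness (λ t → K (curveAt F C t)) (allFin q)
                         (ℕtoℚ-cancel-< {0} {hits F C K} (<-≤-trans B.0<a many))
    in countTrue-positive K (allPoints q (suc n)) (∈-allPoints (curveAt F C t)) Kt

  small : card S ℕ.≤ Q → B.bound ^ℚ suc n ≤ ℕtoℚ (card K)
  small s≤Q = ≤-trans
    (^ℚ-mono-≤ (suc n) B.0≤bound (B.bound≤1 (cancel-≤ (ℕtoℚ Q) (ℕtoℚ-mono-< {0} {Q} 0<Q)
      (subst₂ _≤_ (sym lamqQ≡s) (sym (*-identityˡ (ℕtoℚ Q))) (ℕtoℚ-mono-≤ {card S} {Q} s≤Q)))))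
    (subst (_≤ ℕtoℚ (card K)) (sym (1^ℚ (suc n))) (ℕtoℚ-mono-≤ {1} {card K} 1≤K))

  module Large (Q≤s : Q ℕ.≤ card S) (α β : ℕ) (0<β : 0 ℕ.< β) (aβ≡α : η * ℕtoℚ q * ℕtoℚ β ≡ ℕtoℚ α) where
    r = card S ℕ.∸ Q
    M = Q ℕ.* α ℕ.+ β ℕ.* Λ ℕ.* r
    s≡ : card S ≡ Q ℕ.+ r
    s≡ = sym (ℕₚ.m+[n∸m]≡n Q≤s)
    0<β' : 0ℚ < ℕtoℚ β
    0<β' = ℕtoℚ-mono-< {0} {β} 0<β
    Λβ<α : Λ ℕ.* β ℕ.< α
    Λβ<α = ℕtoℚ-cancel-< {Λ ℕ.* β} {α}
      (subst₂ _<_ (sym (ℕtoℚ-* Λ β)) aβ≡α (*-monoˡ-<-pos (ℕtoℚ β) {{positive 0<β'}} Λ<ηq))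
    0<M : 0 ℕ.< M
    0<M = ℕₚ.≤-trans (ℕₚ.*-mono-≤ 0<Q (ℕₚ.≤-trans (ℕ.s≤s ℕ.z≤n) Λβ<α)) (ℕₚ.m≤m+n (Q ℕ.* α) _)
    curves' : ∀ x → S x ≡ true → ∃ λ (C : Curve≤ q (suc n) Λ) → PassesThrough F C x × α ℕ.≤ hits F C K ℕ.* β
    curves' x Sx = let C , through , many = curves x Sx in C , through ,
      ℕtoℚ-cancel-≤ {α} {hits F C K ℕ.* β} (subst₂ _≤_ aβ≡α (sym (ℕtoℚ-* (hits F C K) β))
        (*-monoʳ-≤-nonNeg (ℕtoℚ β) {{nonNegative (<⇒≤ 0<β')}} many))
    bound-M : B.bound * ℕtoℚ M ≡ ℕtoℚ (card S ℕ.* α)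
    bound-M = begin
      B.bound * ℕtoℚ M
        ≡⟨ cong (B.bound *_) (trans (ℕtoℚ-+ (Q ℕ.* α) (β ℕ.* Λ ℕ.* r)) (cong₂ _+_ (ℕtoℚ-* Q α)
             (trans (ℕtoℚ-* (β ℕ.* Λ) r) (cong (_* ℕtoℚ r) (ℕtoℚ-* β Λ))))) ⟩
      B.bound * (ℕtoℚ Q * ℕtoℚ α + ℕtoℚ β * ℕtoℚ Λ * ℕtoℚ r)
        ≡⟨ B.bound-fraction (ℕtoℚ Q) (ℕtoℚ α) (ℕtoℚ β) (ℕtoℚ r) (trans lamqQ≡s (trans (cong ℕtoℚ s≡) (ℕtoℚ-+ Q r))) aβ≡α ⟩
      (ℕtoℚ Q + ℕtoℚ r) * ℕtoℚ α
        ≡⟨ cong (_* ℕtoℚ α) (trans (sym (ℕtoℚ-+ Q r)) (cong ℕtoℚ (sym s≡))) ⟩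
      ℕtoℚ (card S) * ℕtoℚ α
        ≡⟨ ℕtoℚ-* (card S) α ⟨
      ℕtoℚ (card S ℕ.* α) ∎
      where open ≡-Reasoning
    large : B.bound ^ℚ suc n ≤ ℕtoℚ (card K)
    large = power-bound (suc n) (card K) (card S ℕ.* α) M B.bound 0<M bound-M
      (curves-bound F n Λ α β r S K 0<Λ {{ℕ.>-nonZero 0<β}} Λβ<α s≡ curves')

  bound^n≤K : B.bound ^ℚ suc n ≤ ℕtoℚ (card K)
  bound^n≤K = [ (λ Q≤s → let α , β , aβ≡α = positive-fraction (η * ℕtoℚ q) B.0<a in
                  Large.large Q≤s α (suc β) (ℕ.s≤s ℕ.z≤n) aβ≡α) , small ]′ (ℕₚ.≤-total Q (card S))
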